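{- Let $p$ be a prime. There is a constant $C$ (depending at most on $p$) such that for every $n\ge1$, every bilinear circuit over $GF(p)$ that computes the product of two $n\times n$ matrices has at least $\left(2.5+\frac{1.5}{p^3-1}\right)n^2 - Cn^{7/4}$ product gates.
   Context: The inputs are two $n\times n$ matrices of variables $x,y$ and the outputs are the $n^2$ entries $(x\cdot y)_{i,j}=\sum_{k}x_{i,k}y_{k,j}$. An arithmetic circuit over a field is a directed acyclic graph whose in-degree-0 nodes are input variables, edges carry field constants, and other nodes are sum or product gates. A bilinear circuit is an arithmetic circuit in which every product gate multiplies a linear form in the variables of $x$ only by a linear form in the variables of $y$ only. -}

module Defs where

open import Data.Nat using (ℕ; zero; suc; _+_; _*_; _∸_; _^_; _≤_; NonZero)
open import Data.Nat.DivMod using (_mod_)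
open import Data.Fin using (Fin; zero; suc; toℕ; _≟_)
open import Data.Product using (_×_; _,_)
open import Data.Sum using (_⊎_)
open import Data.Unit using (⊤)
open import Relation.Nullary using (yes; no)
open import Relation.Binary.PropositionalEquality using (_≡_)

module GF (p : ℕ) .{{_ : NonZero p}} where

  F : Set
  F = Fin p

  0F 1F : F
  0F = 0 mod p
  1F = 1 mod p

  infixl 6 _+F_
  infixl 7 _*F_
  _+F_ _*F_ : F → F → F
  a +F b = (toℕ a + toℕ b) mod p
  a *F b = (toℕ a * toℕ b) mod p

  ΣF : (k : ℕ) → (Fin k → F) → F
  ΣF zero    f = 0F
  ΣF (suc k) f = f zero +F ΣF k (λ i → f (suc i))

-- Bilinear circuits for n×n matrix multiplication over GF(p).
--
-- Variables: x i j  and  y i j  (i j : Fin n).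
-- The polynomial computed by a gate of a bilinear circuit is a linear
-- form in the x's, plus a linear form in the y's, plus a bilinear form
-- Σ q(a,b,c,d) x_{a b} y_{c d}; a value is represented exactly by these
-- coefficient tables.

module Circuits (p : ℕ) .{{_ : NonZero p}} (n : ℕ) where
  open GF p public

  record Val : Set where
    field
      lx : Fin n → Fin n → F
      ly : Fin n → Fin n → F
      q  : Fin n → Fin n → Fin n → Fin n → F
  open Val public

  _≈V_ : Val → Val → Set
  u ≈V v = (∀ a b → lx u a b ≡ lx v a b) × (∀ a b → ly u a b ≡ ly v a b)
         × (∀ a b c d → q u a b c d ≡ q v a b c d)

  δ : Fin n → Fin n → F
  δ a b with a ≟ b
  ... | yes _ = 1F
  ... | no  _ = 0F

  varX varY : Fin n → Fin n → Val
  varX i j = record { lx = λ a b → δ a i *F δ b j ; ly = λ _ _ → 0F ; q = λ _ _ _ _ → 0F }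
  varY i j = record { lx = λ _ _ → 0F ; ly = λ a b → δ a i *F δ b j ; q = λ _ _ _ _ → 0F }

  lin : (k : ℕ) → (Fin k → F) → (Fin k → Val) → Val
  lin k c v = record
    { lx = λ a b → ΣF k (λ j → c j *F lx (v j) a b)
    ; ly = λ a b → ΣF k (λ j → c j *F ly (v j) a b)
    ; q  = λ a b c' d → ΣF k (λ j → c j *F q (v j) a b c' d) }

  -- product (α u)·(β v), exact whenever one factor is a linear form in x
  -- only and the other a linear form in y only (the bilinear condition).
  mul : F → Val → F → Val → Val
  mul α u β v = record
    { lx = λ _ _ → 0F ; ly = λ _ _ → 0F
    ; q  = λ a b c d → (α *F β) *F (lx u a b *F ly v c d +F lx v a b *F ly u c d) }

  -- A gate whose inputs may come from any of the k earlier gates.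
  -- Edges carry field constants; a missing edge is an edge with constant 0.
  data Gate (k : ℕ) : Set where
    inX  : Fin n → Fin n → Gate k
    inY  : Fin n → Fin n → Gate k
    sumG : (Fin k → F) → Gate k
    prodG : F → Fin k → F → Fin k → Gate k

  -- A circuit with s gates, listed in topological order.
  data Circuit : ℕ → Set where
    []  : Circuit zero
    _▷_ : ∀ {k} → Circuit k → Gate k → Circuit (suc k)

  gateVal : ∀ {k} → (Fin k → Val) → Gate k → Val
  gateVal {k} vs (inX i j) = varX i j
  gateVal {k} vs (inY i j) = varY i j
  gateVal {k} vs (sumG c) = lin k c vs
  gateVal {k} vs (prodG α i β j) = mul α (vs i) β (vs j)

  values : ∀ {k} → Circuit k → Fin k → Val
  values [] ()
  values (Γ ▷ g) zero = gateVal (values Γ) g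
  values (Γ ▷ g) (suc i) = values Γ i

  XLinear YLinear : Val → Set
  XLinear u = (∀ a b → ly u a b ≡ 0F) × (∀ a b c d → q u a b c d ≡ 0F)
  YLinear u = (∀ a b → lx u a b ≡ 0F) × (∀ a b c d → q u a b c d ≡ 0F)

  GateBilinear : ∀ {k} → (Fin k → Val) → Gate k → Set
  GateBilinear vs (prodG α i β j) =
    (XLinear (vs i) × YLinear (vs j)) ⊎ (YLinear (vs i) × XLinear (vs j))
  GateBilinear vs _ = ⊤

  IsBilinear : ∀ {k} → Circuit k → Set
  IsBilinear [] = ⊤
  IsBilinear (Γ ▷ g) = IsBilinear Γ × GateBilinear (values Γ) g

  isProd : ∀ {k} → Gate k → ℕ
  isProd (prodG _ _ _ _) = 1
  isProd _ = 0

  productGates : ∀ {k} → Circuit k → ℕ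
  productGates [] = 0
  productGates (Γ ▷ g) = productGates Γ + isProd g

  -- the polynomial (x·y)_{ij} = Σ_k x_{ik} y_{kj}
  matMulEntry : Fin n → Fin n → Val
  matMulEntry i j = record
    { lx = λ _ _ → 0F ; ly = λ _ _ → 0F
    ; q  = λ a b c d → δ a i *F δ b c *F δ d j }

  ComputesMatMul : ∀ {s} → Circuit s → (Fin n → Fin n → Fin s) → Set
  ComputesMatMul Γ out = ∀ i j → values Γ (out i j) ≈V matMulEntry i j

-- a ≤ b + c · m^{7/4}   (exact, over the reals), for naturals a b c m:
-- equivalent to (a ∸ b)^4 ≤ c^4 · m^7.
LeqPlusRoot74 : ℕ → ℕ → ℕ → ℕ → Set
LeqPlusRoot74 a b c m = (a ∸ b) ^ 4 ≤ c ^ 4 * m ^ 7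

{-# OPTIONS --safe #-}
module Submission where

-- Write x·y = Σₖ μₖ(x) ηₖ(y) zₖ with one term per product gate. For a triple of
-- matrices (A, B, C), the Koszul matrix [[A, 0, C], [0, A, B], [B, -C, 0]], tensored with
-- the identity of size n, is a sum over k of matrices of rank at most 2, nonzero only
-- if μₖ does not vanish on the triple. So if the Koszul matrix is nearly invertible, then
-- about 3n²/2 of the forms μₖ are nonzero on the triple.
--
-- To find triples on which many forms vanish, take n² of the forms as coordinates. For
-- suitable families Aₗ, Bₗ, Cₗ (l ≤ κ) built from Toeplitz shifts, all triples of nonzero
-- combinations (Σ αₗ Aₗ, Σ βₗ Bₗ, Σ γₗ Cₗ) have a nearly invertible Koszul matrix. This is
-- detected by a function of the coordinates of degree O(n p^{3κ}), and such a function,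
-- being nonzero somewhere, is nonzero at a point with O(n p^{3κ}) nonzero coordinates
-- only. At such families all but O(n p^{3κ}) of the n² coordinate forms vanish, while each
-- remaining form vanishes on an average triple with probability at least p⁻³. Hence
-- 3n²/2 ≲ (m - n²)(1 - p⁻³) for m product gates, and p^κ ≈ n^{1/4} balances the errors.

-- For one matrix A a term contributes rank 1 to A tensored with the identity, so an invertible A
-- forces only n² nonvanishing forms. The Koszul matrix has size 3n, while a term contributes rank
-- at most 2, because the scalar 3×3 matrix is always singular: hence the factor 3/2. The same
-- singularity is the obstacle. If A, B, C commute, the large matrix is singular as well; for
-- invertible A its Schur complement is C A⁻¹ B - B A⁻¹ C. So B and C are given their only block
-- above and below the diagonal, which makes B A⁻¹ C and C A⁻¹ B live in different diagonal blocks
-- and prevents cancellation. One and the same small set of coordinates must serve all triples. The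
-- detecting functions of all p^(3κ+3) triples are therefore multiplied, and this product is what
-- costs the factor p^(3κ). Small κ keeps the product cheap; large κ is wanted because triples with
-- a zero component, a fraction of at most 3 p^(-κ-1), give no information.

open import Defs
open import Algebra.Bundles using (CommutativeSemiring)
import Algebra.Properties.CommutativeSemigroup as CommutativeSemigroupProperties
import Algebra.Properties.Monoid.Sum as MonoidSum
import Algebra.Properties.Semiring.Sum as SemiringSum
import Algebra.Solver.Ring.NaturalCoefficients.Default as NaturalCoefficientsSolver
open import Algebra.Structures using (IsCommutativeSemiring)
open import Data.Bool using (Bool; true; false; if_then_else_)
open import Data.Fin using (Fin; zero; suc; toℕ; fromℕ<; _≟_; punchOut; _↑ˡ_; _↑ʳ_; combine; quotient; remainder; funToFin; finToFun)
open import Data.Fin.Patterns using () renaming (0F to #0; 1F to #1; 2F to #2)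
open import Data.Fin.Permutation using (permutation)
open import Data.Fin.Properties using (any?; all?; toℕ-injective; toℕ-fromℕ<; toℕ<n; suc-injective; punchOut-injective; injective⇒≤; remQuot-combine; combine-remQuot; finToFun-funToFin; funToFin-finToFin)
open import Data.List using (List; []; _∷_; length; _++_; allFin; cartesianProduct; cartesianProductWith)
import Data.List as List
open import Data.List.Membership.Propositional using (_∈_)
open import Data.List.Membership.Propositional.Properties using (∈-allFin; ∈-cartesianProductWith⁺; ∈-cartesianProduct⁺; ∈-lookup)
open import Data.List.Properties using (length-++; length-map; length-tabulate)
open import Data.List.Relation.Unary.All using (All; []; _∷_)
import Data.List.Relation.Unary.All as All
import Data.List.Relation.Unary.All.Properties as All
open import Data.List.Relation.Unary.AllPairs using (AllPairs; []; _∷_)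
open import Data.List.Relation.Unary.Any using (here; there)
open import Data.Nat using (ℕ; zero; suc; _+_; _*_; _∸_; _^_; _≤_; _<_; _<?_; _≤?_; z≤n; s≤s; NonZero; >-nonZero; >-nonZero⁻¹; nonTrivial⇒n>1; ⌊_/2⌋)
open import Data.Nat.DivMod using (_mod_; _%_; %-distribˡ-+; %-distribˡ-*; m<n⇒m%n≡m; m%n<n; n%n≡0)
open import Data.Nat.Divisibility using (_∣_; ∣⇒≤; m%n≡0⇒n∣m)
open import Data.Nat.Primality using (Prime; euclidsLemma; prime⇒nonTrivial)
import Data.Nat.Properties as ℕₚ
open import Data.Nat.Tactic.RingSolver using (solve-∀)
open import Data.Product using (∃-syntax; Σ-syntax; _×_; _,_; proj₁; proj₂)
open import Data.Sum using (_⊎_; inj₁; inj₂)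
open import Data.Unit using (⊤; tt)
open import Data.Vec using (Vec; []; _∷_; lookup; replicate; zipWith; map; tabulate)
import Data.Vec.Functional as Vector
open import Data.Vec.Properties using (lookup∘tabulate; lookup-zipWith; lookup-map; lookup-replicate)
open import Function using (_∘_)
open import Relation.Binary using (tri<; tri≈; tri>)
open import Relation.Binary.PropositionalEquality using (_≡_; _≢_; _≗_; refl; sym; trans; cong; cong₂; subst; isEquivalence)
open import Relation.Nullary using (¬_; Dec; yes; no; contradiction)
open import Relation.Nullary.Decidable using (_×-dec_; ¬?; decidable-stable)

open CommutativeSemigroupProperties ℕₚ.+-commutativeSemigroup using (x∙yz≈y∙xz; interchange)

-- Numerical estimates

cube : ℕ → ℕ
cube x = x * (x * x)

-- `p ^ κ` approximates the fourth root of n up to a factor p. Going from n to n + 1, the exponent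
-- rises by one when the next fourth power is reached.
fourthPower-between : ∀ p → 1 < p → ∀ n → 1 ≤ n → ∃[ κ ] (p ^ κ) ^ 4 ≤ n × n < (p ^ suc κ) ^ 4
fourthPower-between p 1<p (suc zero)    _ =
  0 , s≤s z≤n , ℕₚ.^-monoʳ-< (p * 1) (subst (1 <_) (sym (ℕₚ.*-identityʳ p)) 1<p) {0} {4} (s≤s z≤n)
fourthPower-between p 1<p (suc (suc n)) _ with fourthPower-between p 1<p (suc n) (s≤s z≤n)
... | κ , lower , upper with suc (suc n) ℕₚ.<? (p ^ suc κ) ^ 4
...   | yes below = κ , ℕₚ.m≤n⇒m≤1+n lower , below
...   | no  above = suc κ , ℕₚ.≮⇒≥ above , ℕₚ.≤-<-trans upper (ℕₚ.^-monoˡ-< 4 (ℕₚ.^-monoʳ-< p 1<p (ℕₚ.n<1+n (suc κ))))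

n<p^n : ∀ p → 1 < p → ∀ n → n < p ^ n
n<p^n p 1<p zero    = s≤s z≤n
n<p^n p 1<p (suc n) = ℕₚ.≤-trans (ℕₚ.+-mono-≤ (ℕₚ.m^n>0 p {{>-nonZero (ℕₚ.<⇒≤ 1<p)}} n) (n<p^n p 1<p n))
  (ℕₚ.≤-trans (ℕₚ.≤-reflexive (cong (p ^ n +_) (sym (ℕₚ.+-identityʳ (p ^ n))))) (ℕₚ.*-monoˡ-≤ (p ^ n) 1<p))

-- The summands pay, in order, for the coordinates kept by the mask, for the triples with a zero
-- component, and for the columns lost to halving n and to the width of the Toeplitz band.
constant : ℕ → ℕ
constant p = 6 * (cube p * cube p * p) + 9 * (cube p * cube p) + 9 * cube p

-- Here p P is the number of coefficient vectors, S n the size of the Koszul system and R the number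
-- of forms left after the coordinates are chosen. In the last error term one factor n is traded for
-- (p P)⁴, after which everything is divisible by P³.
averaged-cancelled : ∀ p P n R S .{{_ : NonZero (cube P)}} → S ≤ 3 * n → n ≤ (p * P) ^ 4 →
  cube (p * P) * (S * n) + 2 * (R * cube P) ≤
    2 * (cube (p * P) * (3 * n * p) * cube (p * P) + R * cube (p * P)) + S * n * (3 * (p * P * (p * P))) →
  cube p * (S * n) + 2 * R ≤ 6 * (cube p * cube p * p) * (n * cube P) + 9 * (cube p * cube p) * (n * cube P) + 2 * (R * cube p)
averaged-cancelled p P n R S S≤3n n≤Q⁴ bound = ℕₚ.*-cancelˡ-≤ (cube P) (begin
  cube P * (cube p * (S * n) + 2 * R)
    ≡⟨ left p P (S * n) R ⟩
  cube (p * P) * (S * n) + 2 * (R * cube P)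
    ≤⟨ bound ⟩
  2 * (cube (p * P) * (3 * n * p) * cube (p * P) + R * cube (p * P)) + S * n * (3 * (p * P * (p * P)))
    ≤⟨ ℕₚ.+-monoʳ-≤ (2 * (cube (p * P) * (3 * n * p) * cube (p * P) + R * cube (p * P))) (ℕₚ.*-monoˡ-≤ (3 * (p * P * (p * P))) (ℕₚ.*-mono-≤ S≤3n n≤Q⁴)) ⟩
  2 * (cube (p * P) * (3 * n * p) * cube (p * P) + R * cube (p * P)) + 3 * n * (p * P) ^ 4 * (3 * (p * P * (p * P)))
    ≡⟨ right p P n R ⟩
  cube P * (6 * (cube p * cube p * p) * (n * cube P) + 9 * (cube p * cube p) * (n * cube P) + 2 * (R * cube p)) ∎)
  where
  open ℕₚ.≤-Reasoning
  left : ∀ p P a R → P * (P * P) * (p * (p * p) * a + 2 * R) ≡ p * P * (p * P * (p * P)) * a + 2 * (R * (P * (P * P)))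
  left = solve-∀
  right : ∀ p P n R → 2 * (p * P * (p * P * (p * P)) * (3 * n * p) * (p * P * (p * P * (p * P))) + R * (p * P * (p * P * (p * P)))) + 3 * n * (p * P * (p * P * (p * P * (p * P * 1)))) * (3 * (p * P * (p * P)))
    ≡ P * (P * P) * (6 * (p * (p * p) * (p * (p * p)) * p) * (n * (P * (P * P))) + 9 * (p * (p * p) * (p * (p * p))) * (n * (P * (P * P))) + 2 * (R * (p * (p * p))))
  right = solve-∀

-- With c = p³ - 1 the ratio (5c + 3) / 2c is 5/2 + 3/2c. Of the left side, 2c n² is put aside for
-- the coordinate forms and the other 3(c + 1) n² is the Koszul bound; the difference of the two
-- multiples of R is 2c R, which joins 2c n² to give at most 2c m.
leading-term : ∀ p P n m R S κ c → cube p ≡ suc c → κ ≤ cube P → 1 ≤ cube P → 3 * n ≤ S + (6 * κ + 3) → n * n + R ≤ m →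
  cube p * (S * n) + 2 * R ≤ 6 * (cube p * cube p * p) * (n * cube P) + 9 * (cube p * cube p) * (n * cube P) + 2 * (R * cube p) →
  (5 * c + 3) * (n * n) ≤ 2 * c * m + constant p * (n * cube P)
leading-term p P n m R S κ c p³≡ κ≤P³ 1≤P³ 3n≤ n²+R≤m bound = ℕₚ.+-cancelʳ-≤ (2 * R) _ _ (begin
  (5 * c + 3) * (n * n) + 2 * R
    ≡⟨ split c n R ⟩
  2 * c * (n * n) + (suc c * (3 * n * n) + 2 * R)
    ≤⟨ ℕₚ.+-monoʳ-≤ (2 * c * (n * n)) (ℕₚ.+-monoˡ-≤ (2 * R) (ℕₚ.*-monoʳ-≤ (suc c) (ℕₚ.*-monoˡ-≤ n 3n≤′))) ⟩
  2 * c * (n * n) + (suc c * ((S + 9 * cube P) * n) + 2 * R)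
    ≡⟨ cong (λ x → 2 * c * (n * n) + (x * ((S + 9 * cube P) * n) + 2 * R)) (sym p³≡) ⟩
  2 * c * (n * n) + (cube p * ((S + 9 * cube P) * n) + 2 * R)
    ≡⟨ regroup (2 * c * (n * n)) (cube p) S (cube P) n R ⟩
  2 * c * (n * n) + 9 * cube p * (n * cube P) + (cube p * (S * n) + 2 * R)
    ≤⟨ ℕₚ.+-monoʳ-≤ (2 * c * (n * n) + 9 * cube p * (n * cube P)) bound ⟩
  2 * c * (n * n) + 9 * cube p * (n * cube P) + (6 * (cube p * cube p * p) * (n * cube P) + 9 * (cube p * cube p) * (n * cube P) + 2 * (R * cube p))
    ≡⟨ cong (λ x → 2 * c * (n * n) + 9 * cube p * (n * cube P) + (6 * (cube p * cube p * p) * (n * cube P) + 9 * (cube p * cube p) * (n * cube P) + 2 * (R * x))) p³≡ ⟩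
  2 * c * (n * n) + 9 * cube p * (n * cube P) + (6 * (cube p * cube p * p) * (n * cube P) + 9 * (cube p * cube p) * (n * cube P) + 2 * (R * suc c))
    ≡⟨ collect c (n * n) (9 * cube p) (6 * (cube p * cube p * p)) (9 * (cube p * cube p)) (n * cube P) R ⟩
  2 * c * (n * n + R) + constant p * (n * cube P) + 2 * R
    ≤⟨ ℕₚ.+-monoˡ-≤ (2 * R) (ℕₚ.+-monoˡ-≤ (constant p * (n * cube P)) (ℕₚ.*-monoʳ-≤ (2 * c) n²+R≤m)) ⟩
  2 * c * m + constant p * (n * cube P) + 2 * R ∎)
  where
  open ℕₚ.≤-Reasoning
  3n≤′ : 3 * n ≤ S + 9 * cube P
  3n≤′ = begin
    3 * n                          ≤⟨ 3n≤ ⟩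
    S + (6 * κ + 3 * 1)            ≤⟨ ℕₚ.+-monoʳ-≤ S (ℕₚ.+-mono-≤ (ℕₚ.*-monoʳ-≤ 6 κ≤P³) (ℕₚ.*-monoʳ-≤ 3 1≤P³)) ⟩
    S + (6 * cube P + 3 * cube P)  ≡⟨ cong (S +_) (sym (ℕₚ.*-distribʳ-+ (cube P) 6 3)) ⟩
    S + 9 * cube P                 ∎
  split : ∀ c n R → (5 * c + 3) * (n * n) + 2 * R ≡ 2 * c * (n * n) + ((1 + c) * (3 * n * n) + 2 * R)
  split = solve-∀
  regroup : ∀ a q S T n R → a + (q * ((S + 9 * T) * n) + 2 * R) ≡ a + 9 * q * (n * T) + (q * (S * n) + 2 * R)
  regroup = solve-∀
  collect : ∀ c a x y z t R → 2 * c * a + x * t + (y * t + z * t + 2 * (R * (1 + c))) ≡ 2 * c * (a + R) + (y + z + x) * t + 2 * R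
  collect = solve-∀

-- Since P⁴ ≤ n, the fourth power of n P³ is at most n⁷. The factor D matches the target inequality,
-- which has been multiplied by the denominator of its leading coefficient.
fourthPower-bound : ∀ C n P a b D → 1 ≤ D → P ^ 4 ≤ n → a ≤ b + C * (n * cube P) → (a ∸ b) ^ 4 ≤ (C * D) ^ 4 * n ^ 7
fourthPower-bound C n P a b D 1≤D P⁴≤n a≤ = begin
  (a ∸ b) ^ 4                      ≤⟨ ℕₚ.^-monoˡ-≤ 4 (ℕₚ.m≤n+o⇒m∸n≤o a b a≤) ⟩
  (C * (n * cube P)) ^ 4           ≡⟨ expand C n P ⟩
  C ^ 4 * (n ^ 4 * (P ^ 4) ^ 3)    ≤⟨ ℕₚ.*-mono-≤ (ℕₚ.^-monoˡ-≤ 4 C≤CD) (ℕₚ.*-monoʳ-≤ (n ^ 4) (ℕₚ.^-monoˡ-≤ 3 P⁴≤n)) ⟩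
  (C * D) ^ 4 * (n ^ 4 * n ^ 3)    ≡⟨ cong ((C * D) ^ 4 *_) (sym (ℕₚ.^-distribˡ-+-* n 4 3)) ⟩
  (C * D) ^ 4 * n ^ 7              ∎
  where
  open ℕₚ.≤-Reasoning
  C≤CD : C ≤ C * D
  C≤CD = ℕₚ.≤-trans (ℕₚ.≤-reflexive (sym (ℕₚ.*-identityʳ C))) (ℕₚ.*-monoʳ-≤ C 1≤D)
  expand : ∀ C n P → (C * (n * (P * (P * P)))) * ((C * (n * (P * (P * P)))) * ((C * (n * (P * (P * P)))) * ((C * (n * (P * (P * P)))) * 1)))
    ≡ (C * (C * (C * (C * 1)))) * ((n * (n * (n * (n * 1)))) * ((P * (P * (P * (P * 1)))) * ((P * (P * (P * (P * 1)))) * ((P * (P * (P * (P * 1)))) * 1))))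
  expand = solve-∀

⌊n/2⌋+⌊n/2⌋≤n : ∀ n → ⌊ n /2⌋ + ⌊ n /2⌋ ≤ n
⌊n/2⌋+⌊n/2⌋≤n n = ℕₚ.≤-trans (ℕₚ.+-monoʳ-≤ ⌊ n /2⌋ (ℕₚ.⌊n/2⌋≤⌈n/2⌉ n)) (ℕₚ.≤-reflexive (ℕₚ.⌊n/2⌋+⌈n/2⌉≡n n))

n≤⌊n/2⌋+⌊n/2⌋+1 : ∀ n → n ≤ ⌊ n /2⌋ + ⌊ n /2⌋ + 1
n≤⌊n/2⌋+⌊n/2⌋+1 zero          = z≤n
n≤⌊n/2⌋+⌊n/2⌋+1 (suc zero)    = s≤s z≤n
n≤⌊n/2⌋+⌊n/2⌋+1 (suc (suc n)) = s≤s (subst (suc n ≤_) (cong (_+ 1) (sym (ℕₚ.+-suc ⌊ n /2⌋ ⌊ n /2⌋))) (s≤s (n≤⌊n/2⌋+⌊n/2⌋+1 n)))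

columns-≤ : ∀ n κ → 3 * (2 * (⌊ n /2⌋ ∸ κ)) ≤ 3 * n
columns-≤ n κ = ℕₚ.*-monoʳ-≤ 3 (ℕₚ.≤-trans (ℕₚ.*-monoʳ-≤ 2 (ℕₚ.m∸n≤m ⌊ n /2⌋ κ))
  (ℕₚ.≤-trans (ℕₚ.≤-reflexive (cong (⌊ n /2⌋ +_) (ℕₚ.+-identityʳ ⌊ n /2⌋))) (⌊n/2⌋+⌊n/2⌋≤n n)))

-- Each of the six half-blocks loses κ columns, and an odd n loses one more in each of the three
-- blocks.
columns-≥ : ∀ n κ → 3 * n ≤ 3 * (2 * (⌊ n /2⌋ ∸ κ)) + (6 * κ + 3)
columns-≥ n κ = begin
  3 * n                        ≤⟨ ℕₚ.*-monoʳ-≤ 3 (n≤⌊n/2⌋+⌊n/2⌋+1 n) ⟩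
  3 * (h + h + 1)              ≤⟨ ℕₚ.*-monoʳ-≤ 3 (ℕₚ.+-monoˡ-≤ 1 (ℕₚ.+-mono-≤ h≤ h≤)) ⟩
  3 * (κ + w + (κ + w) + 1)    ≡⟨ regroup κ w ⟩
  3 * (2 * w) + (6 * κ + 3)    ∎
  where
  open ℕₚ.≤-Reasoning
  h = ⌊ n /2⌋
  w = h ∸ κ
  h≤ : h ≤ κ + w
  h≤ = ℕₚ.m≤n+m∸n h κ
  regroup : ∀ κ w → 3 * (κ + w + (κ + w) + 1) ≡ 3 * (2 * w) + (6 * κ + 3)
  regroup = solve-∀

-- Arithmetic in a prime field

-- The carrier stays `Fin p`, so that points can be enumerated and compared, while the operations
-- are abstract and never unfold to modular arithmetic. `characteristic` is phrased with the fold
-- that underlies `sum`.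
record PrimeField (p : ℕ) : Set where
  infixl 6 _+F_
  infixl 7 _*F_
  field
    _+F_ _*F_ : Fin p → Fin p → Fin p
    0F 1F -1F : Fin p
    isCommutativeSemiring : IsCommutativeSemiring _≡_ _+F_ _*F_ 0F 1F
    -1F-inverse           : 1F +F -1F ≡ 0F
    1F≢0F                 : 1F ≢ 0F
    inverse               : ∀ {a} → a ≢ 0F → ∃[ b ] a *F b ≡ 1F
    characteristic        : Vector.foldr _+F_ 0F {p} (λ _ → 1F) ≡ 0F

module Field {p : ℕ} (K : PrimeField p) where

  open PrimeField K

  F : Set
  F = Fin p

  commutativeSemiring : CommutativeSemiring _ _
  commutativeSemiring = record { isCommutativeSemiring = isCommutativeSemiring }

  open CommutativeSemiring commutativeSemiring using (semiring; *-monoid; zeroˡ; zeroʳ; +-identityˡ; +-identityʳ; *-identityˡ; *-identityʳ; +-comm; +-assoc; *-comm; *-assoc; distribˡ; distribʳ)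
  private module Sum = SemiringSum semiring
  open MonoidSum *-monoid using () renaming (sum to product)
  module Solver = NaturalCoefficientsSolver commutativeSemiring

  infix 8 -F_
  -F_ : F → F
  -F a = -1F *F a

  inverseʳ : ∀ a → a +F -F a ≡ 0F
  inverseʳ a = trans (solve 2 (λ a m → a :+ m :* a := (con 1 :+ m) :* a) refl a -1F)
                     (trans (cong (_*F a) -1F-inverse) (zeroˡ a))
    where open Solver

  inverseˡ : ∀ a → -F a +F a ≡ 0F
  inverseˡ a = trans (+-comm (-F a) a) (inverseʳ a)

  +F-cancelʳ : ∀ a b → (a +F b) +F -F b ≡ a
  +F-cancelʳ a b = trans (+-assoc a b (-F b)) (trans (cong (a +F_) (inverseʳ b)) (+-identityʳ a))

  +F-cancelʳ′ : ∀ a b → (a +F -F b) +F b ≡ a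
  +F-cancelʳ′ a b = trans (+-assoc a (-F b) b) (trans (cong (a +F_) (inverseˡ b)) (+-identityʳ a))

  difference≡0⇒≡ : ∀ {a b} → a +F -F b ≡ 0F → a ≡ b
  difference≡0⇒≡ {a} {b} eq = trans (sym (+F-cancelʳ′ a b)) (trans (cong (_+F b) eq) (+-identityˡ b))

  *F-cancel-zero : ∀ {a b} → a ≢ 0F → a *F b ≡ 0F → b ≡ 0F
  *F-cancel-zero {a} {b} a≢0 ab≡0 with inverse a≢0
  ... | a⁻¹ , aa⁻¹≡1 = trans (sym (*-identityˡ b)) (trans (cong (_*F b) (sym aa⁻¹≡1))
    (trans (solve 3 (λ a i b → (a :* i) :* b := i :* (a :* b)) refl a a⁻¹ b) (trans (cong (a⁻¹ *F_) ab≡0) (zeroʳ a⁻¹))))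
    where open Solver

  *F-≢0 : ∀ {a b} → a ≢ 0F → b ≢ 0F → a *F b ≢ 0F
  *F-≢0 a≢0 b≢0 ab≡0 = b≢0 (*F-cancel-zero a≢0 ab≡0)

  -- Opaque, so that the summand can be inferred from an equation between sums.
  abstract
    sum : ∀ {k} → (Fin k → F) → F
    sum = Sum.sum

    sum-empty : (f : Fin 0 → F) → sum f ≡ 0F
    sum-empty f = refl

    sum-suc : ∀ {k} (f : Fin (suc k) → F) → sum f ≡ f zero +F sum (f ∘ suc)
    sum-suc f = refl

    sum-cong : ∀ {k} {f g : Fin k → F} → f ≗ g → sum f ≡ sum g
    sum-cong = Sum.sum-cong-≗

    sum-+ : ∀ {k} (f g : Fin k → F) → sum (λ i → f i +F g i) ≡ sum f +F sum g
    sum-+ = Sum.∑-distrib-+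

    sum-comm : ∀ {k l} (f : Fin k → Fin l → F) → sum (λ i → sum (f i)) ≡ sum (λ j → sum (λ i → f i j))
    sum-comm = Sum.∑-comm

    *-sum : ∀ {k} c (f : Fin k → F) → c *F sum f ≡ sum (λ i → c *F f i)
    *-sum = Sum.*-distribˡ-sum

    sum-* : ∀ {k} (f : Fin k → F) c → sum f *F c ≡ sum (λ i → f i *F c)
    sum-* f c = Sum.*-distribʳ-sum c f

    sum-zero : ∀ {k} {f : Fin k → F} → (∀ i → f i ≡ 0F) → sum f ≡ 0F
    sum-zero {k} f≡0 = trans (Sum.sum-cong-≗ f≡0) (Sum.sum-replicate-zero k)

    sum-const : ∀ x → sum {p} (λ _ → x) ≡ 0F
    sum-const x = trans (Sum.sum-cong-≗ {p} (λ _ → sym (*-identityʳ x)))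
      (trans (sym (Sum.*-distribˡ-sum {p} x (λ _ → 1F))) (trans (cong (x *F_) characteristic) (zeroʳ x)))

    sum-shift : ∀ (f : F → F) b → sum (λ c → f (c +F b)) ≡ sum f
    sum-shift f b = sym (Sum.sum-permute f (permutation (_+F b) (λ c → c +F -F b) (λ c → +F-cancelʳ′ c b) (λ c → +F-cancelʳ c b)))

  sum-single : ∀ {k} (f : Fin k → F) i → (∀ j → j ≢ i → f j ≡ 0F) → sum f ≡ f i
  sum-single f zero others≡0 = trans (sum-suc f)
    (trans (cong (f zero +F_) (sum-zero (λ j → others≡0 (suc j) (λ ())))) (+-identityʳ _))
  sum-single f (suc i) others≡0 = trans (sum-suc f)
    (trans (cong₂ _+F_ (others≡0 zero (λ ())) (sum-single (f ∘ suc) i (λ j j≢i → others≡0 (suc j) (λ { refl → j≢i refl }))))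
           (+-identityˡ _))

  product-≢0 : ∀ {k} {f : Fin k → F} → (∀ i → f i ≢ 0F) → product f ≢ 0F
  product-≢0 {zero}  f≢0 = 1F≢0F
  product-≢0 {suc k} f≢0 = *F-≢0 (f≢0 zero) (product-≢0 (f≢0 ∘ suc))

  product-zero : ∀ {k} (f : Fin k → F) i → f i ≡ 0F → product f ≡ 0F
  product-zero f zero    fi≡0 = trans (cong (_*F product (f ∘ suc)) fi≡0) (zeroˡ (product (f ∘ suc)))
  product-zero f (suc i) fi≡0 = trans (cong (_ *F_) (product-zero (f ∘ suc) i fi≡0)) (zeroʳ _)

  product-cong : ∀ {k} {f g : Fin k → F} → f ≗ g → product f ≡ product g
  product-cong {zero}  f≗g = refl
  product-cong {suc k} f≗g = cong₂ _*F_ (f≗g zero) (product-cong (f≗g ∘ suc))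

  -- Low-degree functions on the Boolean cube

  -- Functions on the Boolean cube whose multilinear expansion has degree < d.
  Degree< : (N d : ℕ) → (Vec Bool N → F) → Set
  Degree< N       zero    f = ∀ J → f J ≡ 0F
  Degree< zero    (suc d) f = ⊤
  Degree< (suc N) (suc d) f =
    Degree< N (suc d) (f ∘ (false ∷_)) ×
    ∃[ δ ] Degree< N d δ × (∀ J → f (true ∷ J) ≡ f (false ∷ J) +F δ J)

  Degree<-ext : ∀ N d {f g} → f ≗ g → Degree< N d f → Degree< N d g
  Degree<-ext N       zero    f≗g f<d = λ J → trans (sym (f≗g J)) (f<d J)
  Degree<-ext zero    (suc d) f≗g f<d = tt
  Degree<-ext (suc N) (suc d) f≗g (f₀<d , δ , δ<d , Δ) =
    Degree<-ext N (suc d) (f≗g ∘ (false ∷_)) f₀<d , δ , δ<d ,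
    (λ J → trans (sym (f≗g _)) (trans (Δ J) (cong (_+F δ J) (f≗g _))))

  Degree<-suc : ∀ N d {f} → Degree< N d f → Degree< N (suc d) f
  Degree<-suc zero    d       f<d = tt
  Degree<-suc (suc N) zero    f<d =
    Degree<-suc N zero (f<d ∘ (false ∷_)) , (λ _ → 0F) , (λ _ → refl) ,
    (λ J → trans (f<d _) (sym (trans (+-identityʳ _) (f<d _))))
  Degree<-suc (suc N) (suc d) (f₀<d , δ , δ<d , Δ) =
    Degree<-suc N (suc d) f₀<d , δ , Degree<-suc N d δ<d , Δ

  Degree<-const : ∀ N c → Degree< N 1 (λ _ → c)
  Degree<-const zero    c = tt
  Degree<-const (suc N) c = Degree<-const N c , (λ _ → 0F) , (λ _ → refl) , (λ _ → sym (+-identityʳ c))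

  Degree<-+ : ∀ N d {f g} → Degree< N d f → Degree< N d g → Degree< N d (λ J → f J +F g J)
  Degree<-+ N       zero    f<d g<d = λ J → trans (cong₂ _+F_ (f<d J) (g<d J)) (+-identityʳ 0F)
  Degree<-+ zero    (suc d) f<d g<d = tt
  Degree<-+ (suc N) (suc d) {f} {g} (f₀<d , δ , δ<d , Δ) (g₀<d , ε , ε<d , Ε) =
    Degree<-+ N (suc d) f₀<d g₀<d , (λ J → δ J +F ε J) , Degree<-+ N d δ<d ε<d ,
    (λ J → trans (cong₂ _+F_ (Δ J) (Ε J))
      (solve 4 (λ a b c d → (a :+ b) :+ (c :+ d) := (a :+ c) :+ (b :+ d)) refl (f (false ∷ J)) (δ J) (g (false ∷ J)) (ε J)))
    where open Solver

  mutual
    -- Discrete product rule: the difference of f g is δ (g₀ + ε) + ε f₀, and in both summands one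
    -- factor has lost a degree. A difference may have the degree bound 0, that is, vanish
    -- identically; the primed version covers this case.
    Degree<-* : ∀ N d e {f g} → Degree< N (suc d) f → Degree< N (suc e) g →
                Degree< N (suc (d + e)) (λ J → f J *F g J)
    Degree<-* zero    d e f<d g<e = tt
    Degree<-* (suc N) d e {f} {g} (f₀<d , δ , δ<d , Δ) (g₀<e , ε , ε<e , Ε) =
      Degree<-* N d e f₀<d g₀<e ,
      (λ J → δ J *F (g (false ∷ J) +F ε J) +F ε J *F f (false ∷ J)) ,
      Degree<-+ N (d + e)
        (Degree<-*′ N d e δ<d (Degree<-+ N (suc e) g₀<e (Degree<-suc N e ε<e)))
        (subst (λ k → Degree< N k (λ J → ε J *F f (false ∷ J))) (ℕₚ.+-comm e d) (Degree<-*′ N e d ε<e f₀<d)) ,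
      (λ J → trans (cong₂ _*F_ (Δ J) (Ε J))
        (solve 4 (λ a b c d → (a :+ b) :* (c :+ d) := a :* c :+ (b :* (c :+ d) :+ d :* a)) refl (f (false ∷ J)) (δ J) (g (false ∷ J)) (ε J)))
      where open Solver

    Degree<-*′ : ∀ N d e {f g} → Degree< N d f → Degree< N (suc e) g →
                 Degree< N (d + e) (λ J → f J *F g J)
    Degree<-*′ N (suc d) e f<d g<e = Degree<-* N d e f<d g<e
    Degree<-*′ N zero    e {f} {g} f≡0 g<e = Degree<-zero N e (λ J → trans (cong (_*F g J) (f≡0 J)) (zeroˡ _))

    Degree<-zero : ∀ N d {f} → (∀ J → f J ≡ 0F) → Degree< N d f
    Degree<-zero N zero    f≡0 = f≡0
    Degree<-zero N (suc d) f≡0 = Degree<-suc N d (Degree<-zero N d f≡0)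

  Degree<-sum : ∀ N d {k} {f : Fin k → Vec Bool N → F} → (∀ i → Degree< N d (f i)) →
                Degree< N d (λ J → sum (λ i → f i J))
  Degree<-sum N d {zero}  f<d = Degree<-zero N d (λ _ → sum-empty _)
  Degree<-sum N d {suc k} f<d = Degree<-ext N d (λ _ → sym (sum-suc _)) (Degree<-+ N d (f<d zero) (Degree<-sum N d (f<d ∘ suc)))

  Degree<-product : ∀ N d {k} {f : Fin k → Vec Bool N → F} → (∀ i → Degree< N (suc d) (f i)) →
                    Degree< N (suc (k * d)) (λ J → product (λ i → f i J))
  Degree<-product N d {zero}  f<d = Degree<-const N 1F
  Degree<-product N d {suc k} f<d = Degree<-* N d (k * d) (f<d zero) (Degree<-product N d (f<d ∘ suc))

  Degree<-mono : ∀ N {d e f} → d ≤ e → Degree< N d f → Degree< N e f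
  Degree<-mono N {zero}  {e}     z≤n       f<d = Degree<-zero N e f<d
  Degree<-mono N {suc d} {suc e} (s≤s d≤e) f<d = go N d≤e f<d
    where
    go : ∀ N {d e f} → d ≤ e → Degree< N (suc d) f → Degree< N (suc e) f
    go zero    d≤e f<d = tt
    go (suc N) d≤e (f₀<d , δ , δ<d , Δ) = go N d≤e f₀<d , δ , Degree<-mono N d≤e δ<d , Δ

  Degree<-scale : ∀ N d c {f} → Degree< N (suc d) f → Degree< N (suc d) (λ J → c *F f J)
  Degree<-scale N d c f<d = Degree<-* N 0 d (Degree<-const N c) f<d

  weight : ∀ {N} → Vec Bool N → ℕ
  weight []          = 0
  weight (true  ∷ J) = suc (weight J)
  weight (false ∷ J) = weight J

  -- A multilinear polynomial of degree < d is determined by its values at points of weight < d. In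
  -- the induction, if the face `false` gives no nonzero value at J, the difference δ is nonzero
  -- there and has smaller degree. At the sparse I found for δ, one of the two points above I works,
  -- and the extra `true` is paid for by that drop in degree.
  sparse-nonzero : ∀ N d {f} → Degree< N d f → ∀ J → f J ≢ 0F → ∃[ I ] f I ≢ 0F × weight I < d
  sparse-nonzero N       zero    f<d J f≢0 = contradiction (f<d J) f≢0
  sparse-nonzero zero    (suc d) f<d [] f≢0 = [] , f≢0 , s≤s z≤n
  sparse-nonzero (suc N) (suc d) (f₀<d , _) (false ∷ J) f≢0 with sparse-nonzero N (suc d) f₀<d J f≢0
  ... | I , fI≢0 , I<d = false ∷ I , fI≢0 , I<d
  sparse-nonzero (suc N) (suc d) {f} (f₀<d , δ , δ<d , Δ) (true ∷ J) f≢0 with f (false ∷ J) ≟ 0F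
  ... | no f₀≢0 = let I , fI≢0 , I<d = sparse-nonzero N (suc d) f₀<d J f₀≢0 in false ∷ I , fI≢0 , I<d
  ... | yes f₀≡0 with sparse-nonzero N d δ<d J (λ δ≡0 → f≢0 (trans (Δ J) (trans (cong₂ _+F_ f₀≡0 δ≡0) (+-identityʳ 0F))))
  ...   | I , δI≢0 , I<d with f (false ∷ I) ≟ 0F
  ...     | no fI≢0 = false ∷ I , fI≢0 , ℕₚ.m<n⇒m<1+n I<d
  ...     | yes fI≡0 = true ∷ I , (λ eq → δI≢0 (trans (sym (trans (Δ I) (trans (cong (_+F δ I) fI≡0) (+-identityˡ _)))) eq)) , s≤s I<d

  -- Counting kernel vectors modulo p

  infixl 6 _+ᵛ_
  infixl 7 _*ᵛ_
  _+ᵛ_ : ∀ {s} → Vec F s → Vec F s → Vec F s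
  _+ᵛ_ = zipWith _+F_

  _*ᵛ_ : ∀ {s} → F → Vec F s → Vec F s
  c *ᵛ v = map (c *F_) v

  0ᵛ : ∀ {s} → Vec F s
  0ᵛ {s} = replicate s 0F

  sumᵛ : ∀ s → (Vec F s → F) → F
  sumᵛ zero    f = f []
  sumᵛ (suc s) f = sum (λ c → sumᵛ s (f ∘ (c ∷_)))

  sumᵛ-cong : ∀ s {f g} → f ≗ g → sumᵛ s f ≡ sumᵛ s g
  sumᵛ-cong zero    f≗g = f≗g []
  sumᵛ-cong (suc s) f≗g = sum-cong (λ c → sumᵛ-cong s (f≗g ∘ (c ∷_)))

  sumᵛ-shift : ∀ s f w → sumᵛ s (λ v → f (v +ᵛ w)) ≡ sumᵛ s f
  sumᵛ-shift zero    f []      = refl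
  sumᵛ-shift (suc s) f (b ∷ w) =
    trans (sum-cong (λ c → sumᵛ-shift s (f ∘ ((c +F b) ∷_)) w)) (sum-shift (λ c → sumᵛ s (f ∘ (c ∷_))) b)

  sumᵛ-zero : ∀ s {f} → (∀ v → f v ≡ 0F) → sumᵛ s f ≡ 0F
  sumᵛ-zero zero    f≡0 = f≡0 []
  sumᵛ-zero (suc s) f≡0 = sum-zero (λ c → sumᵛ-zero s (f≡0 ∘ (c ∷_)))

  -- The fibres along a direction w ≠ 0 have p elements each.
  sumᵛ-invariant : ∀ s f w i → lookup w i ≢ 0F → (∀ c v → f (v +ᵛ c *ᵛ w) ≡ f v) → sumᵛ s f ≡ 0F
  sumᵛ-invariant (suc s) f (b ∷ w) i w≢0 inv with b ≟ 0F
  sumᵛ-invariant (suc s) f (b ∷ w) zero    w≢0 inv | yes b≡0 = contradiction b≡0 w≢0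
  sumᵛ-invariant (suc s) f (b ∷ w) (suc i) w≢0 inv | yes refl = sum-zero (λ x → sumᵛ-invariant s (f ∘ (x ∷_)) w i w≢0
    (λ c v → trans (cong (λ y → f (y ∷ (v +ᵛ c *ᵛ w))) (sym (trans (cong (x +F_) (zeroʳ c)) (+-identityʳ x)))) (inv c (x ∷ v))))
  sumᵛ-invariant (suc s) f (b ∷ w) i w≢0 inv | no b≢0 with inverse b≢0
  ... | b⁻¹ , bb⁻¹≡1 = trans (sum-cong fibre) (sum-const (sumᵛ s (f ∘ (0F ∷_))))
    where
    open Solver
    head≡0 : ∀ x → x +F (-F (x *F b⁻¹)) *F b ≡ 0F
    head≡0 x = trans (cong (x +F_) (trans (solve 4 (λ m x i b → (m :* (x :* i)) :* b := m :* (x :* (b :* i))) refl -1F x b⁻¹ b)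
      (cong -F_ (trans (cong (x *F_) bb⁻¹≡1) (*-identityʳ x))))) (inverseʳ x)
    -- Translation by -(x / b) w carries the slice with head x to the slice with head 0; the
    -- translation that it causes on the tail is absorbed by `sumᵛ-shift`.
    fibre : ∀ x → sumᵛ s (f ∘ (x ∷_)) ≡ sumᵛ s (f ∘ (0F ∷_))
    fibre x = trans (sumᵛ-cong s (λ v → trans (sym (inv (-F (x *F b⁻¹)) (x ∷ v)))
      (cong (λ y → f (y ∷ (v +ᵛ (-F (x *F b⁻¹)) *ᵛ w))) (head≡0 x)))) (sumᵛ-shift s (f ∘ (0F ∷_)) _)

  sumᵛ-single : ∀ s f → (∀ v i → lookup v i ≢ 0F → f v ≡ 0F) → sumᵛ s f ≡ f 0ᵛ
  sumᵛ-single zero    f f≡0 = refl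
  sumᵛ-single (suc s) f f≡0 =
    trans (sum-single _ 0F (λ c c≢0 → sumᵛ-zero s (λ v → f≡0 (c ∷ v) zero c≢0)))
          (sumᵛ-single s (f ∘ (0F ∷_)) (λ v i → f≡0 (0F ∷ v) (suc i)))

  Degree<-sumᵛ : ∀ N d s {f : Vec F s → Vec Bool N → F} → (∀ v → Degree< N d (f v)) →
                 Degree< N d (λ J → sumᵛ s (λ v → f v J))
  Degree<-sumᵛ N d zero    f<d = f<d []
  Degree<-sumᵛ N d (suc s) f<d = Degree<-sum N d (λ c → Degree<-sumᵛ N d s (f<d ∘ (c ∷_)))

  -- Putting 1 at c = 0 removes the root u = 0 from the product over all of `Fin p`; what remains is
  -- u^(p-1) - 1.
  zeroTestFactor : F → F → F
  zeroTestFactor u c with c ≟ 0F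
  ... | yes _ = 1F
  ... | no  _ = u +F c

  -- A polynomial of degree p - 1 in u whose only non-root is 0.
  zeroTest : F → F
  zeroTest u = product (zeroTestFactor u)

  zeroTest-0 : zeroTest 0F ≢ 0F
  zeroTest-0 = product-≢0 factor≢0
    where
    factor≢0 : ∀ c → zeroTestFactor 0F c ≢ 0F
    factor≢0 c with c ≟ 0F
    ... | yes _   = 1F≢0F
    ... | no  c≢0 = λ eq → c≢0 (trans (sym (+-identityˡ c)) eq)

  zeroTest-≢0 : ∀ {u} → u ≢ 0F → zeroTest u ≡ 0F
  zeroTest-≢0 {u} u≢0 = product-zero _ (-F u) factor≡0
    where
    factor≡0 : zeroTestFactor u (-F u) ≡ 0F
    factor≡0 with -F u ≟ 0F
    ... | no  _    = inverseʳ u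
    ... | yes -u≡0 = contradiction (trans (sym (+-identityʳ u)) (trans (cong (u +F_) (sym -u≡0)) (inverseʳ u))) u≢0

  -- The constant factor is counted as if it were linear, hence degree at most p instead of p - 1.
  Degree<-zeroTest : ∀ N {f} → Degree< N 2 f → Degree< N (suc p) (λ J → zeroTest (f J))
  Degree<-zeroTest N {f} f<2 = subst (λ k → Degree< N (suc k) (λ J → zeroTest (f J))) (ℕₚ.*-identityʳ p) (Degree<-product N 1 factor)
    where
    factor : ∀ c → Degree< N 2 (λ J → zeroTestFactor (f J) c)
    factor c with c ≟ 0F
    ... | yes _ = Degree<-suc N 1 (Degree<-const N 1F)
    ... | no  _ = Degree<-+ N 2 f<2 (Degree<-suc N 1 (Degree<-const N c))

  Linear : ∀ {s} → (Vec F s → F) → Set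
  Linear L = ∀ v c w → L (v +ᵛ c *ᵛ w) ≡ L v +F c *F L w

  TrivialKernel : ∀ {r s} → (Fin r → Vec F s → F) → Set
  TrivialKernel L = ∀ w → (∀ i → L i w ≡ 0F) → ∀ j → lookup w j ≡ 0F

  -- Up to a nonzero factor, the number of kernel vectors modulo p: unlike the
  -- indicator of a trivial kernel, it visibly has low degree in the entries.
  kernelCount : ∀ {r s} → (Fin r → Vec F s → F) → F
  kernelCount {r} {s} L = sumᵛ s (λ v → product (λ i → zeroTest (L i v)))

  -- A nonzero kernel vector w leaves every summand unchanged under translation along w, so the sum
  -- vanishes fibre by fibre.
  kernelCount-≢0⇒trivial : ∀ {r s} (L : Fin r → Vec F s → F) → (∀ i → Linear (L i)) → kernelCount L ≢ 0F → TrivialKernel L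
  kernelCount-≢0⇒trivial L lin count≢0 w Lw≡0 j with lookup w j ≟ 0F
  ... | yes wj≡0 = wj≡0
  ... | no  wj≢0 = contradiction (sumᵛ-invariant _ _ w j wj≢0 (λ c v → product-cong (λ i → cong zeroTest
    (trans (lin i v c w) (trans (cong (λ x → L i v +F c *F x) (Lw≡0 i)) (trans (cong (L i v +F_) (zeroʳ c)) (+-identityʳ _))))))) count≢0

  -- Only the zero vector survives the tests, and its summand is a product of copies of
  -- `zeroTest 0F`.
  kernelCount-trivial⇒≢0 : ∀ {r s} (L : Fin r → Vec F s → F) → (∀ i → L i 0ᵛ ≡ 0F) → TrivialKernel L → kernelCount L ≢ 0F
  kernelCount-trivial⇒≢0 {r} {s} L L0≡0 trivial eq = product-≢0 {r}
    (λ i test≡0 → zeroTest-0 (trans (cong zeroTest (sym (L0≡0 i))) test≡0))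
    (trans (sym (sumᵛ-single s _ nonzero)) eq)
    where
    nonzero : ∀ v j → lookup v j ≢ 0F → product (λ i → zeroTest (L i v)) ≡ 0F
    nonzero v j vj≢0 with any? (λ i → ¬? (L i v ≟ 0F))
    ... | yes (i , Liv≢0) = product-zero _ i (zeroTest-≢0 Liv≢0)
    ... | no  none = contradiction (trivial v Lv≡0 j) vj≢0
      where
      Lv≡0 : ∀ i → L i v ≡ 0F
      Lv≡0 i with L i v ≟ 0F
      ... | yes eq = eq
      ... | no neq = contradiction (i , neq) none

  -- Each of the r equations costs degree p. Summing over all p^s vectors is free, so the number of
  -- unknowns does not enter.
  Degree<-kernelCount : ∀ N {r s} {L : Vec Bool N → Fin r → Vec F s → F} →
    (∀ i v → Degree< N 2 (λ J → L J i v)) → Degree< N (suc (r * p)) (λ J → kernelCount (L J))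
  Degree<-kernelCount N {r} {s} L<2 =
    Degree<-sumᵛ N (suc (r * p)) s (λ v → Degree<-product N p (λ i → Degree<-zeroTest N (L<2 i v)))

  -- Linear forms and dual bases

  infix 8 _·_
  _·_ : ∀ {N} → (Fin N → F) → (Fin N → F) → F
  w · x = sum (λ i → w i *F x i)

  ·-cong : ∀ {N} (w : Fin N → F) {x y} → x ≗ y → w · x ≡ w · y
  ·-cong w x≗y = sum-cong (λ i → cong (w i *F_) (x≗y i))

  ·-+ : ∀ {N} (w x y : Fin N → F) → w · (λ i → x i +F y i) ≡ w · x +F w · y
  ·-+ w x y = trans (sum-cong (λ i → distribˡ (w i) (x i) (y i))) (sum-+ (λ i → w i *F x i) (λ i → w i *F y i))

  ·-* : ∀ {N} (w : Fin N → F) c x → w · (λ i → c *F x i) ≡ c *F w · x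
  ·-* w c x = trans (sum-cong (λ i → solve 3 (λ w c x → w :* (c :* x) := c :* (w :* x)) refl (w i) c (x i)))
                    (sym (*-sum c (λ i → w i *F x i)))
    where open Solver

  ·-0 : ∀ {N} (w : Fin N → F) {x} → (∀ i → x i ≡ 0F) → w · x ≡ 0F
  ·-0 w x≡0 = sum-zero (λ i → trans (cong (w i *F_) (x≡0 i)) (zeroʳ (w i)))

  1<p : 1 < p
  1<p = go 1F 0F 1F≢0F
    where
    go : ∀ {q} (a b : Fin q) → a ≢ b → 1 < q
    go {suc zero}    zero zero a≢b = contradiction refl a≢b
    go {suc (suc q)} a    b    a≢b = s≤s (s≤s z≤n)

  funToFin-cong : ∀ {m n} {f g : Fin m → Fin n} → f ≗ g → funToFin f ≡ funToFin g
  funToFin-cong {zero}  f≗g = refl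
  funToFin-cong {suc m} f≗g = cong₂ combine (f≗g zero) (funToFin-cong (f≗g ∘ suc))

  Separates : ∀ {N} → List (Fin N → F) → Set
  Separates ws = ∀ x → All (λ w → w · x ≡ 0F) ws → ∀ i → x i ≡ 0F

  all-lookup : ∀ {A : Set} {P : A → Set} (as : List A) → (∀ i → P (List.lookup as i)) → All P as
  all-lookup []       h = []
  all-lookup (a ∷ as) h = h zero ∷ all-lookup as (h ∘ suc)

  -- Counting takes the place of elimination: evaluating the forms is an injection from p^N points
  -- into p^(length ws) value tuples.
  separates⇒≤ : ∀ {N} (ws : List (Fin N → F)) → Separates ws → N ≤ length ws
  separates⇒≤ {N} ws sep = ℕₚ.≮⇒≥ (λ len<N → ℕₚ.<⇒≱ (ℕₚ.^-monoʳ-< p 1<p len<N) (injective⇒≤ injective))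
    where
    values : Fin (p ^ N) → Fin (length ws) → F
    values y i = List.lookup ws i · finToFun y
    injective : ∀ {y z} → funToFin (values y) ≡ funToFin (values z) → y ≡ z
    injective {y} {z} eq = trans (sym (funToFin-finToFin {N} {p} y)) (trans (funToFin-cong same) (funToFin-finToFin {N} {p} z))
      where
      value : ∀ i → values y i ≡ values z i
      value i = trans (sym (finToFun-funToFin (values y) i)) (trans (cong (λ f → finToFun f i) eq) (finToFun-funToFin (values z) i))
      killed : ∀ i → List.lookup ws i · (λ c → finToFun y c +F -F finToFun {p} {N} z c) ≡ 0F
      killed i = trans (·-+ w (finToFun y) (λ c → -F finToFun {p} {N} z c))
        (trans (cong₂ _+F_ (value i) (·-* w -1F (finToFun z))) (inverseʳ (w · finToFun z)))
        where w = List.lookup ws i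
      same : ∀ c → finToFun {p} {N} y c ≡ finToFun z c
      same c = difference≡0⇒≡ (sep _ (all-lookup ws killed) c)

  separates? : ∀ {N} (ws : List (Fin N → F)) →
    Separates ws ⊎ ∃[ x ] All (λ w → w · x ≡ 0F) ws × ∃[ i ] x i ≢ 0F
  separates? {N} ws with any? {n = p ^ N} (λ y → All.all? (λ w → w · finToFun y ≟ 0F) ws ×-dec any? (λ i → ¬? (finToFun {p} {N} y i ≟ 0F)))
  ... | yes (y , found) = inj₂ (finToFun y , found)
  ... | no none = inj₁ λ x killed i → decidable-stable (x i ≟ 0F) λ xi≢0 → none
    ( funToFin x
    , All.map (λ {w} eq → trans (·-cong w (finToFun-funToFin x)) eq) killed
    , i , (λ eq → xi≢0 (trans (sym (finToFun-funToFin x i)) eq)))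

  ∑ : ∀ {A : Set} → List A → (A → ℕ) → ℕ
  ∑ []       f = 0
  ∑ (a ∷ as) f = f a + ∑ as f

  module Selection {A : Set} {N : ℕ} (μ : A → Fin N → F) where

    Selected : Set
    Selected = List (A × (Fin N → F))

    forms : List A → List (Fin N → F)
    forms = List.map μ

    selectedForms : Selected → List (Fin N → F)
    selectedForms = List.map (μ ∘ proj₁)

    Orthogonal : (a b : A × (Fin N → F)) → Set
    Orthogonal (s , e) (t , f) = μ s · f ≡ 0F × μ t · e ≡ 0F

    -- `splits` says that Φ is the multiset union of the selected and the remaining elements, in the
    -- form in which it is used: for sums of arbitrary weights. The vectors paired with the selected
    -- elements form the dual basis.
    record DualSelection (Φ : List A) : Set where
      field
        selected   : Selected
        rest       : List A
        splits     : ∀ f → ∑ Φ f ≡ ∑ selected (f ∘ proj₁) + ∑ rest f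
        unit       : All (λ (s , e) → μ s · e ≡ 1F) selected
        orthogonal : AllPairs Orthogonal selected
        separates  : Separates (selectedForms selected)

    -- A form is discarded if the others still separate points. The kept forms are
    -- then a minimal separating family, and the failures of separation
    -- found on the way form the dual basis.
    select-from : (S : Selected) (R : List A) →
      All (λ (s , e) → μ s · e ≡ 1F) S → AllPairs Orthogonal S →
      All (λ (s , e) → All (λ r → μ r · e ≡ 0F) R) S →
      Separates (selectedForms S ++ forms R) →
      Σ[ S′ ∈ Selected ] Σ[ R′ ∈ List A ]
        (∀ f → ∑ S (f ∘ proj₁) + ∑ R f ≡ ∑ S′ (f ∘ proj₁) + ∑ R′ f) ×
        All (λ (s , e) → μ s · e ≡ 1F) S′ × AllPairs Orthogonal S′ × Separates (selectedForms S′)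
    select-from S [] unit orth cross sep =
      S , [] , (λ _ → refl) , unit , orth , λ x killed → sep x (All.++⁺ killed [])
    select-from S (r ∷ R) unit orth cross sep with separates? (selectedForms S ++ forms R)
    ... | inj₁ sep′ with select-from S R unit orth (All.map All.tail cross) sep′
    ...   | S′ , R′ , eq , rest =
      S′ , r ∷ R′ , (λ f → trans (x∙yz≈y∙xz (∑ S (f ∘ proj₁)) (f r) (∑ R f))
        (trans (cong (f r +_) (eq f)) (sym (x∙yz≈y∙xz (∑ S′ (f ∘ proj₁)) (f r) (∑ R′ f))))) , rest
    select-from S (r ∷ R) unit orth cross sep | inj₂ (x , killed , i , xi≢0)
      with μ r · x ≟ 0F
    ... | yes rx≡0 = contradiction (sep x (All.++⁺ (All.++⁻ˡ (selectedForms S) killed) (rx≡0 ∷ All.++⁻ʳ (selectedForms S) killed)) i) xi≢0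
    ... | no rx≢0 with inverse rx≢0
    -- The point x shows that r cannot be dropped: all other forms, selected or still pending,
    -- vanish on it, but r does not. Scaled to value 1 it is the dual vector of r, and it is
    -- orthogonal also to every form selected later.
    ...   | c , rxc≡1 with select-from ((r , e) ∷ S) R
              (trans (·-* (μ r) c x) (trans (*-comm c (μ r · x)) rxc≡1) ∷ unit)
              (All.zip (All.map All.head cross , All.map⁻ (e-killed (All.++⁻ˡ (selectedForms S) killed))) ∷ orth)
              (All.map⁻ (e-killed (All.++⁻ʳ (selectedForms S) killed)) ∷ All.map All.tail cross)
              (λ { y (ry≡0 ∷ ys) → sep y (All.++⁺ (All.++⁻ˡ (selectedForms S) ys) (ry≡0 ∷ All.++⁻ʳ (selectedForms S) ys)) })
      where
      e : Fin N → F
      e i = c *F x i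
      e-killed : ∀ {ws} → All (λ w → w · x ≡ 0F) ws → All (λ w → w · e ≡ 0F) ws
      e-killed = All.map (λ {w} wx≡0 → trans (·-* w c x) (trans (cong (c *F_) wx≡0) (zeroʳ c)))
    ...     | S′ , R′ , eq , rest = S′ , R′ , (λ f → trans (x∙yz≈y∙xz (∑ S (f ∘ proj₁)) (f r) (∑ R f)) (trans (sym (ℕₚ.+-assoc (f r) _ _)) (eq f))) , rest

    select : ∀ Φ → Separates (forms Φ) → DualSelection Φ
    select Φ sep with select-from [] Φ [] [] [] sep
    ... | S , R , eq , unit , orth , sep′ = record
      { selected = S ; rest = R ; splits = eq ; unit = unit ; orthogonal = orth ; separates = sep′ }

    -- The point whose dual-basis coordinates agree with those of x on J and are 0 elsewhere. For
    -- fixed x it is affine in the bits of J, and all low-degree bounds start from this.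
    masked : (S : Selected) → Vec Bool (length S) → (Fin N → F) → Fin N → F
    masked []            []          x c = 0F
    masked ((s , e) ∷ S) (true  ∷ J) x c = masked S J x c +F (μ s · x) *F e c
    masked ((s , e) ∷ S) (false ∷ J) x c = masked S J x c

    Degree<-masked : ∀ S x c → Degree< (length S) 2 (λ J → masked S J x c)
    Degree<-masked []            x c = tt
    Degree<-masked ((s , e) ∷ S) x c =
      Degree<-masked S x c , (λ _ → (μ s · x) *F e c) , Degree<-const (length S) _ , (λ _ → refl)

    ·-masked-0 : ∀ S J x (w : Fin N → F) → All (λ (s , e) → w · e ≡ 0F) S → w · masked S J x ≡ 0F
    ·-masked-0 []            []          x w [] = ·-0 w (λ _ → refl)
    ·-masked-0 ((s , e) ∷ S) (false ∷ J) x w (we≡0 ∷ wS≡0) = ·-masked-0 S J x w wS≡0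
    ·-masked-0 ((s , e) ∷ S) (true  ∷ J) x w (we≡0 ∷ wS≡0) =
      trans (·-+ w (masked S J x) (λ c → (μ s · x) *F e c))
        (trans (cong₂ _+F_ (·-masked-0 S J x w wS≡0)
          (trans (·-* w (μ s · x) e) (trans (cong ((μ s · x) *F_) we≡0) (zeroʳ _)))) (+-identityʳ 0F))

    ·-masked-orthogonal : ∀ S J x (w : Fin N → F) s e b → w · e ≡ 0F → w · masked ((s , e) ∷ S) (b ∷ J) x ≡ w · masked S J x
    ·-masked-orthogonal S J x w s e false we≡0 = refl
    ·-masked-orthogonal S J x w s e true  we≡0 =
      trans (·-+ w (masked S J x) (λ c → (μ s · x) *F e c))
        (trans (cong (w · masked S J x +F_) (trans (·-* w (μ s · x) e) (trans (cong ((μ s · x) *F_) we≡0) (zeroʳ _)))) (+-identityʳ _))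

    -- Both points have the same selected coordinates, and the selected forms separate points.
    masked-all : ∀ S x → All (λ (s , e) → μ s · e ≡ 1F) S → AllPairs Orthogonal S → Separates (selectedForms S) →
                 ∀ c → masked S (replicate _ true) x c ≡ x c
    masked-all S x unit orth sep c = sym (difference≡0⇒≡ (sep (λ c → x c +F -F full S c) (All.map⁺ (All.map (λ {a} → agree {a}) (values S unit orth))) c))
      where
      full : ∀ S → Fin N → F
      full S = masked S (replicate _ true) x
      values : ∀ S → All (λ (s , e) → μ s · e ≡ 1F) S → AllPairs Orthogonal S → All (λ (s , _) → μ s · full S ≡ μ s · x) S
      values []            []          []          = []
      values ((s , e) ∷ S) (se≡1 ∷ us) (os ∷ orth) =
        trans (·-+ (μ s) (full S) (λ c → (μ s · x) *F e c))
          (trans (cong₂ _+F_ (·-masked-0 S _ x (μ s) (All.map proj₁ os))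
                             (trans (·-* (μ s) (μ s · x) e) (trans (cong ((μ s · x) *F_) se≡1) (*-identityʳ _)))) (+-identityˡ _))
        ∷ All.map (λ {(t , _)} (eq , te≡0) → trans (·-masked-orthogonal S _ x (μ t) s e true te≡0) eq)
            (All.zip (values S us orth , All.map proj₂ os))
      agree : ∀ {a : A × (Fin N → F)} → μ (proj₁ a) · full S ≡ μ (proj₁ a) · x → μ (proj₁ a) · (λ c → x c +F -F full S c) ≡ 0F
      agree {s , _} eq = trans (·-+ (μ s) x (λ c → -F full S c))
        (trans (cong₂ _+F_ refl (trans (·-* (μ s) -1F (full S)) (cong -F_ eq))) (inverseʳ (μ s · x)))

    Unmasked : ∀ {B : Set} → (B → Set) → (bs : List B) → Vec Bool (length bs) → Set
    Unmasked P []       []          = ⊤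
    Unmasked P (b ∷ bs) (true  ∷ J) = Unmasked P bs J
    Unmasked P (b ∷ bs) (false ∷ J) = P b × Unmasked P bs J

    Unmasked-map : ∀ {B : Set} {P Q R : B → Set} → (∀ {b} → Q b → P b → R b) →
      ∀ bs J → All Q bs → Unmasked P bs J → Unmasked R bs J
    Unmasked-map f []       []          []       um        = tt
    Unmasked-map f (b ∷ bs) (true  ∷ J) (q ∷ qs) um        = Unmasked-map f bs J qs um
    Unmasked-map f (b ∷ bs) (false ∷ J) (q ∷ qs) (pb , um) = f q pb , Unmasked-map f bs J qs um

    -- A masked point is a combination of dual vectors of masked forms only, and an unmasked form
    -- annihilates all of these, whatever x is.
    unmasked-vanish : ∀ S J → AllPairs Orthogonal S → Unmasked (λ (s , _) → ∀ x → μ s · masked S J x ≡ 0F) S J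
    unmasked-vanish []            []          []          = tt
    unmasked-vanish ((s , e) ∷ S) (true  ∷ J) (os ∷ orth) =
      Unmasked-map (λ {(t , _)} (_ , te≡0) h x → trans (·-masked-orthogonal S J x (μ t) s e true te≡0) (h x)) S J os (unmasked-vanish S J orth)
    unmasked-vanish ((s , e) ∷ S) (false ∷ J) (os ∷ orth) =
      (λ x → ·-masked-0 S J x (μ s) (All.map proj₁ os)) , unmasked-vanish S J orth

    ∑-unmasked : ∀ {B : Set} (f : B → ℕ) M → (∀ b → f b ≤ M) → ∀ bs J → Unmasked (λ b → f b ≡ 0) bs J → ∑ bs f ≤ weight J * M
    ∑-unmasked f M f≤M []       []          um          = z≤n
    ∑-unmasked f M f≤M (b ∷ bs) (true  ∷ J) um          = ℕₚ.+-mono-≤ (f≤M b) (∑-unmasked f M f≤M bs J um)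
    ∑-unmasked f M f≤M (b ∷ bs) (false ∷ J) (fb≡0 , um) =
      subst (λ k → k + ∑ bs f ≤ weight J * M) (sym fb≡0) (∑-unmasked f M f≤M bs J um)

  sum-++ : ∀ m {n} (f : Fin (m + n) → F) → sum f ≡ sum (λ i → f (i ↑ˡ n)) +F sum (λ j → f (m ↑ʳ j))
  sum-++ zero    f = sym (trans (cong (_+F sum f) (sum-empty _)) (+-identityˡ (sum f)))
  sum-++ (suc m) f = trans (sum-suc f) (trans (cong (f zero +F_) (sum-++ m (f ∘ suc)))
    (trans (sym (+-assoc _ _ _)) (cong₂ _+F_ (sym (sum-suc _)) refl)))

  sum-combine : ∀ {m n} (f : Fin (m * n) → F) → sum f ≡ sum (λ i → sum (λ j → f (combine {m} {n} i j)))
  sum-combine {zero}      f = trans (sum-empty f) (sym (sum-empty _))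
  sum-combine {suc m} {n} f = trans (sum-++ n f) (trans (cong₂ _+F_ refl (sum-combine {m} {n} (λ k → f (n ↑ʳ k)))) (sym (sum-suc _)))

  -- Koszul matrices

  koszul : (Fin 3 → F) → Fin 3 → Fin 3 → F
  koszul a #0 #0 = a #0
  koszul a #0 #1 = 0F
  koszul a #0 #2 = a #2
  koszul a #1 #0 = 0F
  koszul a #1 #1 = a #0
  koszul a #1 #2 = a #1
  koszul a #2 #0 = a #1
  koszul a #2 #1 = -F a #2
  koszul a #2 #2 = 0F

  koszul-cong : ∀ {a b} → a ≗ b → ∀ u t → koszul a u t ≡ koszul b u t
  koszul-cong a≗b #0 #0 = a≗b #0
  koszul-cong a≗b #0 #1 = refl
  koszul-cong a≗b #0 #2 = a≗b #2
  koszul-cong a≗b #1 #0 = refl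
  koszul-cong a≗b #1 #1 = a≗b #0
  koszul-cong a≗b #1 #2 = a≗b #1
  koszul-cong a≗b #2 #0 = a≗b #1
  koszul-cong a≗b #2 #1 = cong -F_ (a≗b #2)
  koszul-cong a≗b #2 #2 = refl

  koszul-zero : ∀ {a} → (∀ r → a r ≡ 0F) → ∀ u t → koszul a u t ≡ 0F
  koszul-zero a≡0 #0 #0 = a≡0 #0
  koszul-zero a≡0 #0 #1 = refl
  koszul-zero a≡0 #0 #2 = a≡0 #2
  koszul-zero a≡0 #1 #0 = refl
  koszul-zero a≡0 #1 #1 = a≡0 #0
  koszul-zero a≡0 #1 #2 = a≡0 #1
  koszul-zero a≡0 #2 #0 = a≡0 #1
  koszul-zero a≡0 #2 #1 = trans (cong -F_ (a≡0 #2)) (zeroʳ -1F)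
  koszul-zero a≡0 #2 #2 = refl

  Degree<-koszul : ∀ N {a : Vec Bool N → Fin 3 → F} → (∀ r → Degree< N 2 (λ J → a J r)) → ∀ u t → Degree< N 2 (λ J → koszul (a J) u t)
  Degree<-koszul N a<2 #0 #0 = a<2 #0
  Degree<-koszul N a<2 #0 #1 = Degree<-zero N 2 (λ _ → refl)
  Degree<-koszul N a<2 #0 #2 = a<2 #2
  Degree<-koszul N a<2 #1 #0 = Degree<-zero N 2 (λ _ → refl)
  Degree<-koszul N a<2 #1 #1 = a<2 #0
  Degree<-koszul N a<2 #1 #2 = a<2 #1
  Degree<-koszul N a<2 #2 #0 = a<2 #1
  Degree<-koszul N a<2 #2 #1 = Degree<-scale N 1 -1F (a<2 #2)
  Degree<-koszul N a<2 #2 #2 = Degree<-zero N 2 (λ _ → refl)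

  -- Every entry of the Koszul matrix is 0 or plus or minus one coordinate, so a decomposition of
  -- the coordinates carries over entry by entry.
  koszul-decompose : ∀ {m} (x : Fin 3 → F) y (w e : Fin m → F) (a : Fin m → Fin 3 → F) →
    (∀ r → x r *F y ≡ sum (λ k → w k *F (a k r *F e k))) →
    ∀ u t → koszul x u t *F y ≡ sum (λ k → w k *F (koszul (a k) u t *F e k))
  koszul-decompose {m} x y w e a h = go
    where
    none : 0F *F y ≡ sum (λ k → w k *F (0F *F e k))
    none = trans (zeroˡ y) (sym (sum-zero (λ k → trans (cong (w k *F_) (zeroˡ (e k))) (zeroʳ (w k)))))
    go : ∀ u t → koszul x u t *F y ≡ sum (λ k → w k *F (koszul (a k) u t *F e k))
    go #0 #0 = h #0
    go #0 #1 = none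
    go #0 #2 = h #2
    go #1 #0 = none
    go #1 #1 = h #0
    go #1 #2 = h #1
    go #2 #0 = h #1
    go #2 #1 = trans (*-assoc -1F (x #2) y) (trans (cong (-1F *F_) (h #2)) (trans (*-sum -1F (λ k → w k *F (a k #2 *F e k)))
      (sum-cong (λ k → solve 4 (λ m w a e → m :* (w :* (a :* e)) := w :* ((m :* a) :* e)) refl -1F (w k) (a k #2) (e k)))))
      where open Solver
    go #2 #2 = none

  -- The three rows satisfy a₁ · row₀ - a₂ · row₁ = a₀ · row₂.
  koszul-rank : ∀ a → Σ[ α ∈ (Fin 3 → F) ] Σ[ β ∈ (Fin 3 → F) ] ∀ u → ∃[ x ] ∃[ y ] ∀ t → koszul a u t ≡ x *F α t +F y *F β t
  koszul-rank a with a #0 ≟ 0F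
  ... | no a₀≢0 = koszul a #0 , koszul a #1 , λ
      { #0 → 1F , 0F , λ t → sym (first (koszul a #0 t) (koszul a #1 t))
      ; #1 → 0F , 1F , λ t → sym (second (koszul a #0 t) (koszul a #1 t))
      ; #2 → i *F a #1 , i *F -F a #2 , λ
          { #0 → sym (trans (cong₂ _+F_ refl (zeroʳ (i *F -F a #2))) (trans (+-identityʳ _) (cancel (a #1))))
          ; #1 → sym (trans (cong₂ _+F_ (zeroʳ (i *F a #1)) refl) (trans (+-identityˡ _) (cancel (-F a #2))))
          ; #2 → sym (trans (solve 4 (λ i b c m → (i :* b) :* c :+ (i :* (m :* c)) :* b := (con 1 :+ m) :* (i :* (b :* c))) refl i (a #1) (a #2) -1F)
                   (trans (cong (_*F (i *F (a #1 *F a #2))) -1F-inverse) (zeroˡ _))) } }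
    where
    open Solver
    i = proj₁ (inverse a₀≢0)
    first : ∀ x y → 1F *F x +F 0F *F y ≡ x
    first x y = trans (cong₂ _+F_ (*-identityˡ x) (zeroˡ y)) (+-identityʳ x)
    second : ∀ x y → 0F *F x +F 1F *F y ≡ y
    second x y = trans (cong₂ _+F_ (zeroˡ x) (*-identityˡ y)) (+-identityˡ y)
    cancel : ∀ b → (i *F b) *F a #0 ≡ b
    cancel b = trans (solve 3 (λ i b a → (i :* b) :* a := (a :* i) :* b) refl i b (a #0))
      (trans (cong (_*F b) (proj₂ (inverse a₀≢0))) (*-identityˡ b))
  -- Without a₀ the first two rows have only their third entry left, so both are multiples of the
  -- third unit vector.
  ... | yes a₀≡0 = e₂ , koszul a #2 , λ
      { #0 → a #2 , 0F , λ { #0 → trans a₀≡0 (sym (left (a #2) (a #1))) ; #1 → sym (left (a #2) (-F a #2)) ; #2 → sym (right (a #2)) }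
      ; #1 → a #1 , 0F , λ { #0 → sym (left (a #1) (a #1)) ; #1 → trans a₀≡0 (sym (left (a #1) (-F a #2))) ; #2 → sym (right (a #1)) }
      ; #2 → 0F , 1F , λ t → sym (trans (cong₂ _+F_ (zeroˡ (e₂ t)) (*-identityˡ (koszul a #2 t))) (+-identityˡ _)) }
    where
    e₂ : Fin 3 → F
    e₂ #0 = 0F
    e₂ #1 = 0F
    e₂ #2 = 1F
    left : ∀ x y → x *F 0F +F 0F *F y ≡ 0F
    left x y = trans (cong₂ _+F_ (zeroʳ x) (zeroˡ y)) (+-identityʳ 0F)
    right : ∀ x → x *F 1F +F 0F *F 0F ≡ x
    right x = trans (cong₂ _+F_ (*-identityʳ x) (zeroˡ 0F)) (+-identityʳ x)

  allZero? : (a : Fin 3 → F) → Dec (∀ r → a r ≡ 0F)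
  allZero? a = all? (λ r → a r ≟ 0F)

  nonzeroIndicator : (Fin 3 → F) → ℕ
  nonzeroIndicator a with allZero? a
  ... | yes _ = 0
  ... | no  _ = 1

  module Decomposition (n : ℕ) (δ : Fin n → Fin n → F) (δ-same : ∀ a → δ a a ≡ 1F) (δ-diff : ∀ {a b} → a ≢ b → δ a b ≡ 0F) where

    Term : Set
    Term = (Fin (n * n) → F) × (Fin n → Fin n → F)

    μ : Term → Fin (n * n) → F
    μ = proj₁

    η : Term → Fin n → Fin n → F
    η = proj₂

    -- Multiplication of the matrix x by the elementary matrix with its 1 in position (b , d).
    Computes : (Φ : List Term) (z : Fin n → Fin n → Fin (length Φ) → F) → Set
    Computes Φ z = ∀ x i j b d → x (combine i b) *F δ d j ≡
      sum (λ k → z i j k *F (μ (List.lookup Φ k) · x *F η (List.lookup Φ k) b d))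

    Triple : Set
    Triple = Fin 3 → Fin (n * n) → F

    values : Triple → Term → Fin 3 → F
    values X φ r = μ φ · X r

    module Columns {s : ℕ} (block : Fin s → Fin 3) (col : Fin s → Fin n) where

      -- Row i of block row u of the Koszul matrix, restricted to s chosen columns and applied to v.
      -- All 3n rows are kept; a trivial kernel on nearly 3n columns is the meaning of near
      -- invertibility here.
      row : Triple → Fin 3 → Fin n → Vec F s → F
      row X u i v = sum (λ c → koszul (λ r → X r (combine i (col c))) u (block c) *F lookup v c)

      rows : Triple → Fin (3 * n) → Vec F s → F
      rows X ui = row X (quotient n ui) (remainder {3} n ui)

      row-linear : ∀ X u i → Linear (row X u i)
      row-linear X u i v c w = trans (sum-cong step) (trans (sum-+ _ _) (cong (row X u i v +F_) (sym (*-sum c _))))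
        where
        open Solver
        k = λ e → koszul (λ r → X r (combine i (col e))) u (block e)
        step : ∀ e → k e *F lookup (v +ᵛ c *ᵛ w) e ≡ k e *F lookup v e +F c *F (k e *F lookup w e)
        step e = trans (cong (k e *F_) (trans (lookup-zipWith _+F_ e v (c *ᵛ w)) (cong (lookup v e +F_) (lookup-map e (c *F_) w))))
          (solve 4 (λ k v c w → k :* (v :+ c :* w) := k :* v :+ c :* (k :* w)) refl (k e) (lookup v e) c (lookup w e))

      row-0 : ∀ X u i → row X u i 0ᵛ ≡ 0F
      row-0 X u i = sum-zero (λ c → trans (cong (_ *F_) (lookup-replicate c 0F)) (zeroʳ _))

      rows-killed : ∀ X {v} → (∀ u i → row X u i v ≡ 0F) → ∀ ui → rows X ui v ≡ 0F
      rows-killed X h ui = h (quotient n ui) (remainder {3} n ui)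

      rows-killed⁻ : ∀ X {v} → (∀ ui → rows X ui v ≡ 0F) → ∀ u i → row X u i v ≡ 0F
      rows-killed⁻ X {v} h u i = subst (λ ui → row X (proj₁ ui) (proj₂ ui) v ≡ 0F) (remQuot-combine {3} {n} u i) (h (combine u i))

      -- In the Koszul matrix tensored with the identity, a term acts on its input through γ ⊗ η,
      -- where γ runs over the rows of its scalar Koszul matrix.
      functional : Term → (Fin 3 → F) → Fin (s * n) → F
      functional φ γ e = γ (block (quotient n e)) *F η φ (col (quotient n e)) (remainder {s} n e)

      functional-combination : ∀ φ x α y β γ → (∀ t → γ t ≡ x *F α t +F y *F β t) →
        ∀ v → functional φ α · v ≡ 0F → functional φ β · v ≡ 0F → functional φ γ · v ≡ 0F
      functional-combination φ x α y β γ γ≡ v α·v≡0 β·v≡0 = trans (sum-cong step)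
        (trans (sum-+ _ _) (trans (cong₂ _+F_ (sym (*-sum x _)) (sym (*-sum y _)))
          (trans (cong₂ (λ a b → x *F a +F y *F b) α·v≡0 β·v≡0) (trans (cong₂ _+F_ (zeroʳ x) (zeroʳ y)) (+-identityʳ 0F)))))
        where
        open Solver
        step : ∀ e → functional φ γ e *F v e ≡ x *F (functional φ α e *F v e) +F y *F (functional φ β e *F v e)
        step e = trans (cong (λ g → (g *F h) *F v e) (γ≡ (block (quotient n e))))
          (solve 6 (λ x a y b h v → ((x :* a :+ y :* b) :* h) :* v := x :* ((a :* h) :* v) :+ y :* ((b :* h) :* v)) refl x (α (block (quotient n e))) y (β (block (quotient n e))) h (v e))
          where h = η φ (col (quotient n e)) (remainder {s} n e)

      -- The rows γ of a singular 3×3 matrix are spanned by two vectors, so two functionals control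
      -- the whole term, and none is needed if the form vanishes on the triple.
      termFunctionals : Triple → Term → List (Fin (s * n) → F)
      termFunctionals X φ with allZero? (values X φ)
      ... | yes _ = []
      ... | no  _ with koszul-rank (values X φ)
      ...   | α , β , _ = functional φ α ∷ functional φ β ∷ []

      length-termFunctionals : ∀ X φ → length (termFunctionals X φ) ≡ 2 * nonzeroIndicator (values X φ)
      length-termFunctionals X φ with allZero? (values X φ)
      ... | yes _ = refl
      ... | no  _ = refl

      termFunctionals-killed : ∀ X φ v → All (λ w → w · v ≡ 0F) (termFunctionals X φ) → ∀ u → functional φ (koszul (values X φ) u) · v ≡ 0F
      termFunctionals-killed X φ v killed u with allZero? (values X φ)
      ... | yes a≡0 = sum-zero (λ e → trans (cong (_*F v e) (trans (cong (_*F _) (koszul-zero a≡0 u _)) (zeroˡ _))) (zeroˡ (v e)))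
      termFunctionals-killed X φ v (α·v≡0 ∷ β·v≡0 ∷ []) u | no _ =
        let α , β , spans = koszul-rank (values X φ); x , y , γ≡ = spans u
        in functional-combination φ x α y β _ γ≡ v α·v≡0 β·v≡0

      functionals : Triple → List Term → List (Fin (s * n) → F)
      functionals X []      = []
      functionals X (φ ∷ Φ) = termFunctionals X φ ++ functionals X Φ

      length-functionals : ∀ X Φ → length (functionals X Φ) ≡ 2 * ∑ Φ (λ φ → nonzeroIndicator (values X φ))
      length-functionals X []      = refl
      length-functionals X (φ ∷ Φ) = trans (length-++ (termFunctionals X φ))
        (trans (cong₂ _+_ (length-termFunctionals X φ) (length-functionals X Φ)) (sym (ℕₚ.*-distribˡ-+ 2 (nonzeroIndicator (values X φ)) _)))

      functionals-killed : ∀ X Φ v → All (λ w → w · v ≡ 0F) (functionals X Φ) →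
        ∀ u k → functional (List.lookup Φ k) (koszul (values X (List.lookup Φ k)) u) · v ≡ 0F
      functionals-killed X (φ ∷ Φ) v killed u zero    = termFunctionals-killed X φ v (All.++⁻ˡ (termFunctionals X φ) killed) u
      functionals-killed X (φ ∷ Φ) v killed u (suc k) = functionals-killed X Φ v (All.++⁻ʳ (termFunctionals X φ) killed) u k

      module _ (Φ : List Term) (z : Fin n → Fin n → Fin (length Φ) → F) (computes : Computes Φ z) where

        column : (Fin (s * n) → F) → Fin n → Vec F s
        column v d = tabulate (λ c → v (combine c d))

        -- The tensor decomposition, applied to a vector v of s n entries. The identity factor is
        -- `δ d j`: summing against it picks the j-th column of v, and expanding `κ c *F δ d j` by
        -- `Computes` turns the same sum into one over the terms.
        row-column : ∀ X u i v j → row X u i (column v j) ≡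
          sum (λ k → z i j k *F (functional (List.lookup Φ k) (koszul (values X (List.lookup Φ k)) u) · v))
        row-column X u i v j = trans (sum-cong spread) (trans (sym (sum-combine {s} {n} g)) (trans (sum-cong expand)
          (trans (sum-comm _) (sum-cong (λ k → sym (*-sum (z i j k) _))))))
          where
          open Solver
          κ = λ c → koszul (λ r → X r (combine i (col c))) u (block c)
          g : Fin (s * n) → F
          g e = (κ (quotient n e) *F δ (remainder {s} n e) j) *F v e
          g-combine : ∀ c d → g (combine c d) ≡ (κ c *F δ d j) *F v (combine c d)
          g-combine c d = cong (λ cd → (κ (proj₁ cd) *F δ (proj₂ cd) j) *F v (combine c d)) (remQuot-combine {s} {n} c d)
          spread : ∀ c → κ c *F lookup (column v j) c ≡ sum (λ d → g (combine c d))
          spread c = sym (trans (sum-single _ j (λ d d≢j → trans (g-combine c d)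
              (trans (cong (λ b → (κ c *F b) *F v (combine c d)) (δ-diff d≢j)) (trans (cong (_*F v (combine c d)) (zeroʳ (κ c))) (zeroˡ _)))))
            (trans (g-combine c j) (trans (cong (λ b → (κ c *F b) *F v (combine c j)) (δ-same j))
              (trans (cong (_*F v (combine c j)) (*-identityʳ (κ c))) (cong (κ c *F_) (sym (lookup∘tabulate (λ c → v (combine c j)) c)))))))
          expand : ∀ e → g e ≡ sum (λ k → z i j k *F (functional (List.lookup Φ k) (koszul (values X (List.lookup Φ k)) u) e *F v e))
          expand e = trans (cong (_*F v e) (koszul-decompose (λ r → X r (combine i b)) (δ d j) (z i j)
              (λ k → η (List.lookup Φ k) b d) (λ k → values X (List.lookup Φ k)) (λ r → computes (X r) i j b d) u (block (quotient n e))))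
            (trans (sum-* _ (v e)) (sum-cong (λ k → *-assoc (z i j k) _ (v e))))
            where
            b = col (quotient n e)
            d = remainder {s} n e

        -- If all functionals kill v, then every column of v is in the kernel of the restricted
        -- Koszul matrix and v = 0. The functionals thus separate a space of dimension s n, and
        -- there are two for each nonvanishing form.
        koszul-bound : ∀ X → TrivialKernel (rows X) → s * n ≤ 2 * ∑ Φ (λ φ → nonzeroIndicator (values X φ))
        koszul-bound X trivial = subst (s * n ≤_) (length-functionals X Φ) (separates⇒≤ (functionals X Φ) separates)
          where
          separates : Separates (functionals X Φ)
          separates v killed e = trans (cong v (sym (combine-remQuot {s} n e)))
            (trans (sym (lookup∘tabulate (λ c → v (combine c (remainder {s} n e))) (quotient {s} n e)))
            (trivial (column v (remainder {s} n e)) (rows-killed X {column v (remainder {s} n e)} (λ u i → trans (row-column X u i v (remainder {s} n e))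
              (sum-zero (λ k → trans (cong (z i _ k *F_) (functionals-killed X Φ v killed u k)) (zeroʳ _))))) (quotient {s} n e)))

  -- Toeplitz triples

  leading : ∀ {k} (α : Vec F k) i → lookup α i ≢ 0F → ∃[ l ] lookup α l ≢ 0F × (∀ j → toℕ j < toℕ l → lookup α j ≡ 0F)
  leading (a ∷ α) i αi≢0 with a ≟ 0F
  ... | no a≢0 = zero , a≢0 , λ _ ()
  leading (a ∷ α) zero    αi≢0 | yes a≡0 = contradiction a≡0 αi≢0
  leading (a ∷ α) (suc i) αi≢0 | yes a≡0 with leading α i αi≢0
  ... | l , αl≢0 , below = suc l , αl≢0 , λ { zero _ → a≡0 ; (suc j) (s≤s j<l) → below j j<l }

  [_≡ℕ_] : ℕ → ℕ → F
  [ a ≡ℕ b ] with a ℕₚ.≟ b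
  ... | yes _ = 1F
  ... | no  _ = 0F

  [≡ℕ]-same : ∀ a → [ a ≡ℕ a ] ≡ 1F
  [≡ℕ]-same a with a ℕₚ.≟ a
  ... | yes _   = refl
  ... | no  a≢a = contradiction refl a≢a

  [≡ℕ]-diff : ∀ {a b} → a ≢ b → [ a ≡ℕ b ] ≡ 0F
  [≡ℕ]-diff {a} {b} a≢b with a ℕₚ.≟ b
  ... | yes a≡b = contradiction a≡b a≢b
  ... | no  _   = refl

  <∸⇒+< : ∀ {a b c} → a < b ∸ c → a + c < b
  <∸⇒+< {a} {b} {c} a<b∸c with c ≤? b
  ... | yes c≤b = subst (a + c <_) (ℕₚ.m∸n+n≡m c≤b) (ℕₚ.+-monoˡ-< c a<b∸c)
  ... | no  c≰b = contradiction (subst (a <_) (ℕₚ.m≤n⇒m∸n≡0 (ℕₚ.≰⇒≥ c≰b)) a<b∸c) λ ()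

  -- The banded matrix with entry α at index ρ - σ, and 0 outside the range of indices.
  toeplitz : ∀ {k} → Vec F k → ℕ → ℕ → F
  toeplitz α ρ σ = sum (λ l → lookup α l *F [ ρ ≡ℕ σ + toℕ l ])

  -- Let l₀ be the first index with α ≠ 0. In row σ + l₀ the entries right of column σ vanish and
  -- the one in column σ is α at l₀, so these rows form a triangular system. Only h - κ columns are
  -- used so that σ + l₀ < h for every possible l₀.
  toeplitz-kernel : ∀ {κ h} (α : Vec F (suc κ)) i → lookup α i ≢ 0F → (y : Fin (h ∸ κ) → F) →
    (∀ ρ → ρ < h → sum (λ σ → toeplitz α ρ (toℕ σ) *F y σ) ≡ 0F) → ∀ σ → y σ ≡ 0F
  toeplitz-kernel {κ} {h} α i αi≢0 y eqs σ = go (suc (toℕ σ)) σ ℕₚ.≤-refl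
    where
    l₀ = proj₁ (leading α i αi≢0)
    αl₀≢0 = proj₁ (proj₂ (leading α i αi≢0))
    below = proj₂ (proj₂ (leading α i αi≢0))
    go : ∀ m σ → toℕ σ < m → y σ ≡ 0F
    go (suc m) σ (s≤s σ≤m) = *F-cancel-zero αl₀≢0 (trans (sym (trans (sum-single _ σ others)
        (cong (_*F y σ) (trans (sum-single _ l₀ other-shift) (trans (cong (lookup α l₀ *F_) ([≡ℕ]-same ρ)) (*-identityʳ _)))))) (eqs ρ ρ<h))
      where
      ρ = toℕ σ + toℕ l₀
      ρ<h : ρ < h
      ρ<h = ℕₚ.≤-<-trans (ℕₚ.+-monoʳ-≤ (toℕ σ) (ℕₚ.≤-pred (toℕ<n l₀))) (<∸⇒+< (toℕ<n σ))
      other-shift : ∀ l → l ≢ l₀ → lookup α l *F [ ρ ≡ℕ toℕ σ + toℕ l ] ≡ 0F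
      other-shift l l≢l₀ = trans (cong (lookup α l *F_) ([≡ℕ]-diff (λ eq → l≢l₀ (toℕ-injective (sym (ℕₚ.+-cancelˡ-≡ (toℕ σ) _ _ eq)))))) (zeroʳ _)
      others : ∀ τ → τ ≢ σ → toeplitz α ρ (toℕ τ) *F y τ ≡ 0F
      others τ τ≢σ with ℕₚ.<-cmp (toℕ τ) (toℕ σ)
      ... | tri< τ<σ _ _ = trans (cong (toeplitz α ρ (toℕ τ) *F_) (go m τ (ℕₚ.<-≤-trans τ<σ σ≤m))) (zeroʳ _)
      ... | tri≈ _ τ≡σ _ = contradiction (toℕ-injective τ≡σ) τ≢σ
      ... | tri> _ _ σ<τ = trans (cong (_*F y τ) (sum-zero far)) (zeroˡ _)
        where
        far : ∀ l → lookup α l *F [ ρ ≡ℕ toℕ τ + toℕ l ] ≡ 0F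
        far l with toℕ l <? toℕ l₀
        ... | yes l<l₀ = trans (cong (_*F [ ρ ≡ℕ toℕ τ + toℕ l ]) (below l l<l₀)) (zeroˡ _)
        ... | no  l≮l₀ = trans (cong (lookup α l *F_) ([≡ℕ]-diff (ℕₚ.<⇒≢ (ℕₚ.+-mono-<-≤ σ<τ (ℕₚ.≮⇒≥ l≮l₀))))) (zeroʳ _)

  allowed : Fin 3 → Fin 2 → Fin 2 → Bool
  allowed #0 #0 #0 = true
  allowed #0 #1 #1 = true
  allowed #1 #0 #1 = true
  allowed #2 #1 #0 = true
  allowed _  _  _  = false

  -1F≢0F : -1F ≢ 0F
  -1F≢0F eq = 1F≢0F (trans (sym (+-identityʳ 1F)) (trans (cong (1F +F_) (sym eq)) -1F-inverse))

  private
    pattern zeros eq = inj₂ (inj₁ eq)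
    pattern known eq = inj₂ (inj₂ eq)

  module Toeplitz (n h κ : ℕ) (h+h≤n : h + h ≤ n) where

    -- Half and offset of an index. Indices from 2h on, such as the last one for odd n, get an
    -- offset of at least h and are never of the form `pos`; their rows only add equations to the
    -- system.
    decode : Fin n → Fin 2 × ℕ
    decode i with toℕ i <? h
    ... | yes _ = #0 , toℕ i
    ... | no  _ = #1 , toℕ i ∸ h

    pos : Fin 2 → ∀ ρ → ρ < h → Fin n
    pos #0 ρ ρ<h = fromℕ< (ℕₚ.≤-trans ρ<h (ℕₚ.≤-trans (ℕₚ.m≤m+n h h) h+h≤n))
    pos #1 ρ ρ<h = fromℕ< (ℕₚ.≤-trans (ℕₚ.+-monoʳ-< h ρ<h) h+h≤n)

    decode-pos : ∀ β ρ ρ<h → decode (pos β ρ ρ<h) ≡ (β , ρ)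
    decode-pos #0 ρ ρ<h with toℕ (pos #0 ρ ρ<h) <? h
    ... | yes _   = cong (#0 ,_) (toℕ-fromℕ< _)
    ... | no  ≮h  = contradiction (subst (_< h) (sym (toℕ-fromℕ< _)) ρ<h) ≮h
    decode-pos #1 ρ ρ<h with toℕ (pos #1 ρ ρ<h) <? h
    ... | yes <h  = contradiction (subst (_< h) (toℕ-fromℕ< _) <h) (ℕₚ.≤⇒≯ (ℕₚ.m≤m+n h ρ))
    ... | no  _   = cong (#1 ,_) (trans (cong (_∸ h) (toℕ-fromℕ< _)) (ℕₚ.m+n∸m≡n h ρ))

    entry : Fin 3 → ℕ → Fin 2 × ℕ → Fin 2 × ℕ → F
    entry r l (β , ρ) (γ , σ) = if allowed r β γ then [ ρ ≡ℕ σ + l ] else 0F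

    -- A = diag(T, T), B and C have T as their only nonzero block, above respectively below the diagonal.
    shift : Fin 3 → Fin (suc κ) → Fin (n * n) → F
    shift r l e = entry r (toℕ l) (decode (quotient n e)) (decode (remainder {n} n e))

    blockEntry : (Fin 3 → Vec F (suc κ)) → (r : Fin 3) (β γ : Fin 2) (ρ σ : ℕ) → F
    blockEntry α r β γ ρ σ = if allowed r β γ then toeplitz (α r) ρ σ else 0F

    w : ℕ
    w = h ∸ κ

    σ<h : ∀ (σ : Fin w) → toℕ σ < h
    σ<h σ = ℕₚ.≤-trans (toℕ<n σ) (ℕₚ.m∸n≤m h κ)

    column : Fin (2 * w) → Fin n
    column e = pos (quotient {2} w e) (toℕ (remainder {2} w e)) (σ<h (remainder {2} w e))

    s : ℕ
    s = 3 * (2 * w)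

    block : Fin s → Fin 3
    block = quotient (2 * w)

    col : Fin s → Fin n
    col c = column (remainder {3} (2 * w) c)

    module _ (δ : Fin n → Fin n → F) (δ-same : ∀ a → δ a a ≡ 1F) (δ-diff : ∀ {a b} → a ≢ b → δ a b ≡ 0F) where
      open Decomposition n δ δ-same δ-diff
      open Columns block col hiding (column)

      -- Write T, T′, T″ for the Toeplitz blocks of A, B, C. In half-blocks the system reads T V₀₀ =
      -- 0, T V₁₁ = 0, T′ V₀₁ = 0, -T″ V₁₀ = 0, T V₀₁ + T″ V₂₀ = 0 and T V₁₀ + T′ V₂₁ = 0. In this
      -- order every equation has a single new unknown with an injective coefficient. X is only
      -- required to agree pointwise with the combination, as a fully masked triple does.
      shift-trivialKernel : ∀ (α : Fin 3 → Vec F (suc κ)) → (∀ r → ∃[ i ] lookup (α r) i ≢ 0F) →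
        ∀ X → (∀ r e → X r e ≡ sum (λ l → lookup (α r) l *F shift r l e)) → TrivialKernel (rows X)
      shift-trivialKernel α α≢0 X X≡ v killed = conclude
        where
        V : Fin 3 → Fin 2 → Fin w → F
        V t γ σ = lookup v (combine t (combine γ σ))

        entries : ∀ r β ρ ρ<h γ σ → X r (combine (pos β ρ ρ<h) (column (combine γ σ))) ≡ blockEntry α r β γ ρ (toℕ σ)
        entries r β ρ ρ<h γ σ = trans (X≡ r _) (trans (sum-cong (λ l → cong (lookup (α r) l *F_) (shift≡ l))) collapse)
          where
          column≡ : decode (column (combine γ σ)) ≡ (γ , toℕ σ)
          column≡ = trans (cong (λ q → decode (pos (proj₁ q) (toℕ (proj₂ q)) (σ<h (proj₂ q)))) (remQuot-combine {2} {w} γ σ)) (decode-pos γ (toℕ σ) (σ<h σ))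
          shift≡ : ∀ l → shift r l (combine (pos β ρ ρ<h) (column (combine γ σ))) ≡ entry r (toℕ l) (β , ρ) (γ , toℕ σ)
          shift≡ l = trans (cong (λ q → entry r (toℕ l) (decode (proj₁ q)) (decode (proj₂ q))) (remQuot-combine {n} {n} (pos β ρ ρ<h) (column (combine γ σ))))
            (cong₂ (entry r (toℕ l)) (decode-pos β ρ ρ<h) column≡)
          collapse : sum (λ l → lookup (α r) l *F entry r (toℕ l) (β , ρ) (γ , toℕ σ)) ≡ blockEntry α r β γ ρ (toℕ σ)
          collapse with allowed r β γ
          ... | true  = refl
          ... | false = sum-zero (λ l → zeroʳ _)

        coef : (u t : Fin 3) (β γ : Fin 2) (ρ σ : ℕ) → F
        coef u t β γ ρ σ = koszul (λ r → blockEntry α r β γ ρ σ) u t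

        row≡ : ∀ u β ρ ρ<h → row X u (pos β ρ ρ<h) v ≡ sum (λ t → sum (λ γ → sum (λ σ → coef u t β γ ρ (toℕ σ) *F V t γ σ)))
        row≡ u β ρ ρ<h = trans (sum-combine {3} {2 * w} _) (sum-cong (λ t → trans (sum-combine {2} {w} _) (sum-cong (λ γ → sum-cong (λ σ →
          cong (_*F V t γ σ) (trans (cong (λ q → koszul (λ r → X r (combine (pos β ρ ρ<h) (column (proj₂ q)))) u (proj₁ q)) (remQuot-combine {3} {2 * w} t (combine γ σ)))
            (koszul-cong (λ r → entries r β ρ ρ<h γ σ) u t)))))))

        Inactive : (u t : Fin 3) (β γ : Fin 2) → Set
        Inactive u t β γ = (∀ ρ σ → coef u t β γ ρ σ ≡ 0F) ⊎ (∀ σ → V t γ σ ≡ 0F)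

        inactive-sum : ∀ u t β γ ρ → Inactive u t β γ → sum (λ σ → coef u t β γ ρ (toℕ σ) *F V t γ σ) ≡ 0F
        inactive-sum u t β γ ρ (inj₁ coef≡0) = sum-zero (λ σ → trans (cong₂ _*F_ (coef≡0 ρ (toℕ σ)) refl) (zeroˡ _))
        inactive-sum u t β γ ρ (inj₂ V≡0)    = sum-zero (λ σ → trans (cong₂ _*F_ refl (V≡0 σ)) (zeroʳ _))

        -- A row meets six half-blocks of v. Once five of them are known to contribute nothing, a
        -- Toeplitz system in the sixth remains.
        isolate : ∀ u β t₀ γ₀ → (∀ t γ → (t ≡ t₀ × γ ≡ γ₀) ⊎ Inactive u t β γ) →
          ∀ ρ → ρ < h → sum (λ σ → coef u t₀ β γ₀ ρ (toℕ σ) *F V t₀ γ₀ σ) ≡ 0F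
        isolate u β t₀ γ₀ status ρ ρ<h = trans (sym (trans (row≡ u β ρ ρ<h)
            (trans (sum-single _ t₀ (λ t t≢t₀ → sum-zero (λ γ → other t γ (t≢t₀ ∘ proj₁))))
                   (sum-single _ γ₀ (λ γ γ≢γ₀ → other t₀ γ (γ≢γ₀ ∘ proj₂))))))
            (rows-killed⁻ X {v} killed u (pos β ρ ρ<h))
          where
          other : ∀ t γ → ¬ (t ≡ t₀ × γ ≡ γ₀) → sum (λ σ → coef u t β γ ρ (toℕ σ) *F V t γ σ) ≡ 0F
          other t γ ≢₀ with status t γ
          ... | inj₁ ≡₀       = contradiction ≡₀ ≢₀
          ... | inj₂ inactive = inactive-sum u t β γ ρ inactive

        kernel : ∀ r → (y : Fin w → F) → (∀ ρ → ρ < h → sum (λ σ → toeplitz (α r) ρ (toℕ σ) *F y σ) ≡ 0F) → ∀ σ → y σ ≡ 0F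
        kernel r = toeplitz-kernel (α r) (proj₁ (α≢0 r)) (proj₂ (α≢0 r))

        V₀₀ : ∀ σ → V #0 #0 σ ≡ 0F
        V₀₀ = kernel #0 _ (isolate #0 #0 #0 #0 λ
          { #0 #0 → inj₁ (refl , refl) ; #0 #1 → zeros (λ _ _ → refl) ; #1 #0 → zeros (λ _ _ → refl) ; #1 #1 → zeros (λ _ _ → refl)
          ; #2 #0 → zeros (λ _ _ → refl) ; #2 #1 → zeros (λ _ _ → refl) })

        V₁₁ : ∀ σ → V #1 #1 σ ≡ 0F
        V₁₁ = kernel #0 _ (isolate #1 #1 #1 #1 λ
          { #0 #0 → zeros (λ _ _ → refl) ; #0 #1 → zeros (λ _ _ → refl) ; #1 #0 → zeros (λ _ _ → refl) ; #1 #1 → inj₁ (refl , refl)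
          ; #2 #0 → zeros (λ _ _ → refl) ; #2 #1 → zeros (λ _ _ → refl) })

        V₀₁ : ∀ σ → V #0 #1 σ ≡ 0F
        V₀₁ = kernel #1 _ (isolate #2 #0 #0 #1 λ
          { #0 #0 → zeros (λ _ _ → refl) ; #0 #1 → inj₁ (refl , refl) ; #1 #0 → zeros (λ _ _ → zeroʳ -1F) ; #1 #1 → zeros (λ _ _ → zeroʳ -1F)
          ; #2 #0 → zeros (λ _ _ → refl) ; #2 #1 → zeros (λ _ _ → refl) })

        V₁₀ : ∀ σ → V #1 #0 σ ≡ 0F
        V₁₀ = kernel #2 _ (λ ρ ρ<h → *F-cancel-zero -1F≢0F (trans (trans (*-sum -1F _) (sum-cong (λ σ → sym (*-assoc -1F _ _))))
          (isolate #2 #1 #1 #0 (λ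
            { #0 #0 → zeros (λ _ _ → refl) ; #0 #1 → zeros (λ _ _ → refl) ; #1 #0 → inj₁ (refl , refl) ; #1 #1 → zeros (λ _ _ → zeroʳ -1F)
            ; #2 #0 → zeros (λ _ _ → refl) ; #2 #1 → zeros (λ _ _ → refl) }) ρ ρ<h)))

        V₂₀ : ∀ σ → V #2 #0 σ ≡ 0F
        V₂₀ = kernel #2 _ (isolate #0 #1 #2 #0 λ
          { #0 #0 → zeros (λ _ _ → refl) ; #0 #1 → known V₀₁ ; #1 #0 → zeros (λ _ _ → refl) ; #1 #1 → zeros (λ _ _ → refl)
          ; #2 #0 → inj₁ (refl , refl) ; #2 #1 → zeros (λ _ _ → refl) })

        V₂₁ : ∀ σ → V #2 #1 σ ≡ 0F
        V₂₁ = kernel #1 _ (isolate #1 #0 #2 #1 λ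
          { #0 #0 → zeros (λ _ _ → refl) ; #0 #1 → zeros (λ _ _ → refl) ; #1 #0 → known V₁₀ ; #1 #1 → zeros (λ _ _ → refl)
          ; #2 #0 → zeros (λ _ _ → refl) ; #2 #1 → inj₁ (refl , refl) })

        V≡0 : ∀ t γ σ → V t γ σ ≡ 0F
        V≡0 #0 #0 = V₀₀
        V≡0 #0 #1 = V₀₁
        V≡0 #1 #0 = V₁₀
        V≡0 #1 #1 = V₁₁
        V≡0 #2 #0 = V₂₀
        V≡0 #2 #1 = V₂₁

        conclude : ∀ c → lookup v c ≡ 0F
        conclude c = trans (cong (lookup v) (trans (sym (combine-remQuot {3} (2 * w) c))
            (cong (combine (block c)) (sym (combine-remQuot {2} w (remainder {3} (2 * w) c))))))
          (V≡0 (block c) (quotient {2} w (remainder {3} (2 * w) c)) (remainder {2} w (remainder {3} (2 * w) c)))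

  -- Sums over lists and counting in vector spaces

  module _ {A : Set} where

    ∑-cong : ∀ (as : List A) {f g : A → ℕ} → f ≗ g → ∑ as f ≡ ∑ as g
    ∑-cong []       f≗g = refl
    ∑-cong (a ∷ as) f≗g = cong₂ _+_ (f≗g a) (∑-cong as f≗g)

    ∑-mono : ∀ (as : List A) {f g : A → ℕ} → (∀ a → f a ≤ g a) → ∑ as f ≤ ∑ as g
    ∑-mono []       f≤g = z≤n
    ∑-mono (a ∷ as) f≤g = ℕₚ.+-mono-≤ (f≤g a) (∑-mono as f≤g)

    ∑-+ : ∀ (as : List A) (f g : A → ℕ) → ∑ as (λ a → f a + g a) ≡ ∑ as f + ∑ as g
    ∑-+ []       f g = refl
    ∑-+ (a ∷ as) f g = trans (cong (f a + g a +_) (∑-+ as f g)) (interchange (f a) (g a) (∑ as f) (∑ as g))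

    ∑-* : ∀ (as : List A) c (f : A → ℕ) → ∑ as (λ a → c * f a) ≡ c * ∑ as f
    ∑-* []       c f = sym (ℕₚ.*-zeroʳ c)
    ∑-* (a ∷ as) c f = trans (cong (c * f a +_) (∑-* as c f)) (sym (ℕₚ.*-distribˡ-+ c (f a) (∑ as f)))

    ∑-const : ∀ (as : List A) c → ∑ as (λ _ → c) ≡ length as * c
    ∑-const []       c = refl
    ∑-const (a ∷ as) c = cong (c +_) (∑-const as c)

    ∑-zero : ∀ (as : List A) {f : A → ℕ} → (∀ a → f a ≡ 0) → ∑ as f ≡ 0
    ∑-zero as f≡0 = trans (∑-cong as f≡0) (trans (∑-const as 0) (ℕₚ.*-zeroʳ (length as)))

    ∑-∈ : ∀ {as : List A} {a} (f : A → ℕ) → a ∈ as → f a ≤ ∑ as f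
    ∑-∈ {b ∷ as} f (here refl) = ℕₚ.m≤m+n (f b) _
    ∑-∈ {b ∷ as} f (there a∈)  = ℕₚ.≤-trans (∑-∈ f a∈) (ℕₚ.m≤n+m _ (f b))

    ∑-++ : ∀ (as bs : List A) f → ∑ (as ++ bs) f ≡ ∑ as f + ∑ bs f
    ∑-++ []       bs f = refl
    ∑-++ (a ∷ as) bs f = trans (cong (f a +_) (∑-++ as bs f)) (sym (ℕₚ.+-assoc (f a) _ _))

    ∑-map : ∀ {B : Set} (g : B → A) bs f → ∑ (List.map g bs) f ≡ ∑ bs (f ∘ g)
    ∑-map g []       f = refl
    ∑-map g (b ∷ bs) f = cong (f (g b) +_) (∑-map g bs f)

  ∑-swap : ∀ {A B : Set} (as : List A) (bs : List B) (f : A → B → ℕ) →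
    ∑ as (λ a → ∑ bs (f a)) ≡ ∑ bs (λ b → ∑ as (λ a → f a b))
  ∑-swap []       bs f = sym (∑-zero bs (λ _ → refl))
  ∑-swap (a ∷ as) bs f = trans (cong (∑ bs (f a) +_) (∑-swap as bs f)) (sym (∑-+ bs (f a) (λ b → ∑ as (λ a → f a b))))

  ∑-cartesianProductWith : ∀ {A B C : Set} (g : A → B → C) as bs f →
    ∑ (cartesianProductWith g as bs) f ≡ ∑ as (λ a → ∑ bs (λ b → f (g a b)))
  ∑-cartesianProductWith g []       bs f = refl
  ∑-cartesianProductWith g (a ∷ as) bs f = trans (∑-++ (List.map (g a) bs) _ f)
    (cong₂ _+_ (∑-map (g a) bs f) (∑-cartesianProductWith g as bs f))

  ∑-cartesianProduct-* : ∀ {A B : Set} (as : List A) (bs : List B) (f : A → ℕ) (g : B → ℕ) →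
    ∑ (cartesianProduct as bs) (λ (a , b) → f a * g b) ≡ ∑ as f * ∑ bs g
  ∑-cartesianProduct-* as bs f g = trans (∑-cartesianProductWith _,_ as bs _)
    (trans (∑-cong as (λ a → trans (∑-* bs (f a) g) (ℕₚ.*-comm (f a) _))) (trans (∑-* as (∑ bs g) f) (ℕₚ.*-comm (∑ bs g) _)))

  length-cartesianProductWith : ∀ {A B C : Set} (g : A → B → C) as bs → length (cartesianProductWith g as bs) ≡ length as * length bs
  length-cartesianProductWith g as bs = trans (sym (trans (∑-const (cartesianProductWith g as bs) 1) (ℕₚ.*-identityʳ _)))
    (trans (∑-cartesianProductWith g as bs _) (trans (∑-const as (∑ bs (λ _ → 1))) (cong (length as *_) (trans (∑-const bs 1) (ℕₚ.*-identityʳ _)))))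

  allVec : ∀ k → List (Vec F k)
  allVec zero    = [] ∷ []
  allVec (suc k) = cartesianProductWith _∷_ (allFin p) (allVec k)

  ∈-allVec : ∀ {k} (v : Vec F k) → v ∈ allVec k
  ∈-allVec []      = here refl
  ∈-allVec (c ∷ v) = ∈-cartesianProductWith⁺ _∷_ (∈-allFin c) (∈-allVec v)

  length-allVec : ∀ k → length (allVec k) ≡ p ^ k
  length-allVec zero    = refl
  length-allVec (suc k) = trans (length-cartesianProductWith _∷_ (allFin p) (allVec k)) (cong₂ _*_ (length-tabulate {n = p} (λ i → i)) (length-allVec k))

  listProduct : ∀ {A : Set} → List A → (A → F) → F
  listProduct []       f = 1F
  listProduct (a ∷ as) f = f a *F listProduct as f

  listProduct-≢0 : ∀ {A : Set} (as : List A) {f} → (∀ a → f a ≢ 0F) → listProduct as f ≢ 0F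
  listProduct-≢0 []       f≢0 = 1F≢0F
  listProduct-≢0 (a ∷ as) f≢0 = *F-≢0 (f≢0 a) (listProduct-≢0 as f≢0)

  listProduct-≢0⁻ : ∀ {A : Set} {as : List A} {a f} → listProduct as f ≢ 0F → a ∈ as → f a ≢ 0F
  listProduct-≢0⁻ {as = _ ∷ as} {f = f} Πf≢0 (here refl) fa≡0 = Πf≢0 (trans (cong₂ _*F_ fa≡0 refl) (zeroˡ _))
  listProduct-≢0⁻ {as = _ ∷ as} Πf≢0 (there a∈)  = listProduct-≢0⁻ (λ Π≡0 → Πf≢0 (trans (cong₂ _*F_ refl Π≡0) (zeroʳ _))) a∈

  Degree<-listProduct : ∀ N d {A : Set} (as : List A) {f : A → Vec Bool N → F} → (∀ a → Degree< N (suc d) (f a)) →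
    Degree< N (suc (length as * d)) (λ J → listProduct as (λ a → f a J))
  Degree<-listProduct N d []       f<d = Degree<-const N 1F
  Degree<-listProduct N d (a ∷ as) f<d = Degree<-* N d (length as * d) (f<d a) (Degree<-listProduct N d as f<d)

  zeroIndicator : F → ℕ
  zeroIndicator a with a ≟ 0F
  ... | yes _ = 1
  ... | no  _ = 0

  zeroIndicator-0 : ∀ {a} → a ≡ 0F → zeroIndicator a ≡ 1
  zeroIndicator-0 {a} a≡0 with a ≟ 0F
  ... | yes _   = refl
  ... | no  a≢0 = contradiction a≡0 a≢0

  indicators : ∀ a → nonzeroIndicator a + zeroIndicator (a #0) * (zeroIndicator (a #1) * zeroIndicator (a #2)) ≡ 1
  indicators a with allZero? a
  ... | yes a≡0 = cong₂ _*_ (zeroIndicator-0 (a≡0 #0)) (cong₂ _*_ (zeroIndicator-0 (a≡0 #1)) (zeroIndicator-0 (a≡0 #2)))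
  ... | no ¬a≡0 with a #0 ≟ 0F
  ...   | no _ = refl
  ...   | yes a₀≡0 with a #1 ≟ 0F
  ...     | no _ = refl
  ...     | yes a₁≡0 with a #2 ≟ 0F
  ...       | no _ = refl
  ...       | yes a₂≡0 = contradiction (λ { #0 → a₀≡0 ; #1 → a₁≡0 ; #2 → a₂≡0 }) ¬a≡0

  nonzeroIndicator-0 : ∀ {a} → (∀ r → a r ≡ 0F) → nonzeroIndicator a ≡ 0
  nonzeroIndicator-0 {a} a≡0 with allZero? a
  ... | yes _    = refl
  ... | no  a≢0 = contradiction a≡0 a≢0

  combination : ∀ {k} → Vec F k → (Fin k → F) → F
  combination α ψ = sum (λ l → lookup α l *F ψ l)

  -- A hyperplane in dimension κ + 1 has p^κ points. If ψ is nonzero at the first index, every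
  -- choice of the other coefficients extends to a zero; otherwise the first coefficient is free and
  -- the count recurses.
  zeros-≥ : ∀ κ (ψ : Fin (suc κ) → F) → p ^ κ ≤ ∑ (allVec (suc κ)) (λ α → zeroIndicator (combination α ψ))
  zeros-≥ κ ψ = subst (p ^ κ ≤_) (sym (∑-cartesianProductWith _∷_ (allFin p) (allVec κ) _)) (count κ ψ)
    where
    split : ∀ {κ} (ψ : Fin (suc κ) → F) c α → combination (c ∷ α) ψ ≡ c *F ψ zero +F combination α (ψ ∘ suc)
    split ψ c α = sum-suc _
    count : ∀ κ (ψ : Fin (suc κ) → F) → p ^ κ ≤ ∑ (allFin p) (λ c → ∑ (allVec κ) (λ α → zeroIndicator (combination (c ∷ α) ψ)))
    count κ ψ with ψ zero ≟ 0F
    count κ ψ | no ψ₀≢0 = subst (p ^ κ ≤_) (sym (∑-swap (allFin p) (allVec κ) _))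
      (ℕₚ.≤-trans (ℕₚ.≤-reflexive (sym (trans (∑-const (allVec κ) 1) (trans (ℕₚ.*-identityʳ _) (length-allVec κ))))) (∑-mono (allVec κ) one))
      where
      i = proj₁ (inverse ψ₀≢0)
      one : ∀ α → 1 ≤ ∑ (allFin p) (λ c → zeroIndicator (combination (c ∷ α) ψ))
      one α = subst (_≤ ∑ (allFin p) (λ c → zeroIndicator (combination (c ∷ α) ψ)))
        (zeroIndicator-0 root) (∑-∈ (λ c → zeroIndicator (combination (c ∷ α) ψ)) (∈-allFin c₀))
        where
        open Solver
        rest = combination α (ψ ∘ suc)
        c₀ = -F rest *F i
        root : combination (c₀ ∷ α) ψ ≡ 0F
        root = trans (split ψ c₀ α) (trans (cong (_+F rest) (trans (solve 3 (λ r i a → (r :* i) :* a := r :* (a :* i)) refl (-F rest) i (ψ zero))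
          (trans (cong (-F rest *F_) (proj₂ (inverse ψ₀≢0))) (*-identityʳ _)))) (inverseˡ rest))
    count zero ψ | yes ψ₀≡0 = ℕₚ.≤-trans (ℕₚ.≤-trans (ℕₚ.≤-reflexive (sym (zeroIndicator-0 root))) (ℕₚ.m≤m+n _ _))
      (∑-∈ (λ c → ∑ (allVec 0) (λ α → zeroIndicator (combination (c ∷ α) ψ))) (∈-allFin 0F))
      where
      root : combination (0F ∷ []) ψ ≡ 0F
      root = trans (split ψ 0F []) (trans (cong₂ _+F_ (zeroˡ _) (sum-empty _)) (+-identityʳ 0F))
    count (suc κ) ψ | yes ψ₀≡0 = ℕₚ.≤-trans (ℕₚ.≤-reflexive (sym (trans (∑-const (allFin p) (p ^ κ)) (cong (_* p ^ κ) (length-tabulate {n = p} (λ i → i))))))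
      (∑-mono (allFin p) (λ c → subst (p ^ κ ≤_) (∑-cong (allVec (suc κ)) (λ α → cong zeroIndicator (sym (drop c α)))) (zeros-≥ κ (ψ ∘ suc))))
      where
      drop : ∀ c α → combination (c ∷ α) ψ ≡ combination α (ψ ∘ suc)
      drop c α = trans (split ψ c α) (trans (cong₂ _+F_ (trans (cong (c *F_) ψ₀≡0) (zeroʳ c)) refl) (+-identityˡ _))

  nonzero? : ∀ {k} (v : Vec F k) → Dec (∃[ i ] lookup v i ≢ 0F)
  nonzero? v = any? (λ i → ¬? (lookup v i ≟ 0F))

  zeroVecIndicator : ∀ {k} → Vec F k → ℕ
  zeroVecIndicator v with nonzero? v
  ... | yes _ = 0
  ... | no  _ = 1

  ∑-zeroVecIndicator : ∀ k → ∑ (allVec k) zeroVecIndicator ≤ 1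
  ∑-zeroVecIndicator k = ℕₚ.≤-trans (∑-mono (allVec k) bound) (count k)
    where
    isZero : ∀ {k} → Vec F k → ℕ
    isZero []      = 1
    isZero (c ∷ v) = zeroIndicator c * isZero v
    bound : ∀ {k} (v : Vec F k) → zeroVecIndicator v ≤ isZero v
    bound v with nonzero? v
    ... | yes _   = z≤n
    ... | no none = ℕₚ.≤-reflexive (sym (zero-vec v (λ i → decidable-stable (lookup v i ≟ 0F) (λ vi≢0 → none (i , vi≢0)))))
      where
      zero-vec : ∀ {k} (v : Vec F k) → (∀ i → lookup v i ≡ 0F) → isZero v ≡ 1
      zero-vec []      v≡0 = refl
      zero-vec (c ∷ v) v≡0 = cong₂ _*_ (zeroIndicator-0 (v≡0 zero)) (zero-vec v (v≡0 ∘ suc))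
    ∑-tabulate-one : ∀ {m} (g : Fin m → F) → (∀ {i j} → g i ≡ g j → i ≡ j) → ∑ (List.tabulate g) zeroIndicator ≤ 1
    ∑-tabulate-one {zero}  g inj = z≤n
    ∑-tabulate-one {suc m} g inj with g zero ≟ 0F
    ... | no _ = ∑-tabulate-one (g ∘ suc) (λ eq → suc-injective (inj eq))
      where open import Data.Fin.Properties using (suc-injective)
    ... | yes g₀≡0 = s≤s (ℕₚ.≤-reflexive (others (g ∘ suc) (λ i eq → contradiction (inj (trans eq (sym g₀≡0))) λ ())))
      where
      others : ∀ {m} (g : Fin m → F) → (∀ i → g i ≢ 0F) → ∑ (List.tabulate g) zeroIndicator ≡ 0
      others {zero}  g g≢0 = refl
      others {suc m} g g≢0 with g zero ≟ 0F
      ... | yes eq = contradiction eq (g≢0 zero)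
      ... | no  _  = others (g ∘ suc) (g≢0 ∘ suc)
    count : ∀ k → ∑ (allVec k) isZero ≤ 1
    count zero    = s≤s z≤n
    count (suc k) = subst (_≤ 1) (sym (trans (∑-cartesianProductWith _∷_ (allFin p) (allVec k) isZero)
      (trans (∑-cong (allFin p) (λ c → trans (∑-* (allVec k) (zeroIndicator c) isZero) (ℕₚ.*-comm (zeroIndicator c) _)))
             (∑-* (allFin p) (∑ (allVec k) isZero) zeroIndicator))))
      (ℕₚ.*-mono-≤ (count k) (∑-tabulate-one (λ i → i) (λ eq → eq)))

  -- Averaging over triples

  module Averaging (n h κ : ℕ) (h+h≤n : h + h ≤ n)
    (δ : Fin n → Fin n → F) (δ-same : ∀ a → δ a a ≡ 1F) (δ-diff : ∀ {a b} → a ≢ b → δ a b ≡ 0F) where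

    open Decomposition n δ δ-same δ-diff
    open Toeplitz n h κ h+h≤n
    open Columns block col
    open Selection μ

    Coefficients : Set
    Coefficients = Vec F (suc κ) × Vec F (suc κ) × Vec F (suc κ)

    component : Coefficients → Fin 3 → Vec F (suc κ)
    component (α , β , γ) #0 = α
    component (α , β , γ) #1 = β
    component (α , β , γ) #2 = γ

    vectors : List (Vec F (suc κ))
    vectors = allVec (suc κ)

    coefficients : List Coefficients
    coefficients = cartesianProduct vectors (cartesianProduct vectors vectors)

    ∈-coefficients : ∀ τ → τ ∈ coefficients
    ∈-coefficients (α , β , γ) = ∈-cartesianProduct⁺ (∈-allVec α) (∈-cartesianProduct⁺ (∈-allVec β) (∈-allVec γ))

    nonzeroTriple? : ∀ τ → Dec (∀ r → ∃[ i ] lookup (component τ r) i ≢ 0F)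
    nonzeroTriple? τ = all? (λ r → nonzero? (component τ r))

    Q P : ℕ
    Q = p ^ suc κ
    P = p ^ κ

    length-coefficients : length coefficients ≡ Q * (Q * Q)
    length-coefficients = trans (length-cartesianProductWith _,_ vectors _)
      (cong₂ _*_ (length-allVec (suc κ)) (trans (length-cartesianProductWith _,_ vectors vectors) (cong₂ _*_ (length-allVec (suc κ)) (length-allVec (suc κ)))))

    -- If all forms vanish at x, the computed product x · y is zero for every y; the elementary
    -- matrices y recover all entries of x.
    computes⇒separates : ∀ Φ z → Computes Φ z → Separates (forms Φ)
    computes⇒separates Φ z computes x killed e = trans (cong x (sym (combine-remQuot {n} n e)))
      (trans (sym (trans (cong (x (combine i b) *F_) (δ-same i)) (*-identityʳ _)))
      (trans (computes x i i b i) (sum-zero (λ k → trans (cong (z i i k *F_)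
        (trans (cong (_*F η (List.lookup Φ k) b i) (All.lookup (All.map⁻ killed) (∈-lookup k))) (zeroˡ _))) (zeroʳ _)))))
      where
      i = quotient {n} n e
      b = remainder {n} n e

    -- The shifts are masked before they are combined, so one mask J serves all coefficients and the
    -- triple stays linear in them.
    triple : (S : Selected) → Vec Bool (length S) → Coefficients → Triple
    triple S J τ r e = combination (component τ r) (λ l → masked S J (shift r l) e)

    values-triple : ∀ S J τ φ r → values (triple S J τ) φ r ≡ combination (component τ r) (λ l → μ φ · masked S J (shift r l))
    values-triple S J τ φ r = trans (sum-cong (λ e → *-sum (μ φ e) _)) (trans (sum-comm _) (sum-cong (λ l →
        trans (sum-cong (λ e → solve 3 (λ a b c → a :* (b :* c) := b :* (a :* c)) refl (μ φ e) (lookup (component τ r) l) (masked S J (shift r l) e)))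
              (sym (*-sum (lookup (component τ r) l) _)))))
      where open Solver

    -- For a triple with a zero component nothing is claimed; the value 1 keeps such triples from
    -- killing the product over all τ.
    certificate : (S : Selected) → Coefficients → Vec Bool (length S) → F
    certificate S τ J with nonzeroTriple? τ
    ... | yes _ = kernelCount (rows (triple S J τ))
    ... | no  _ = 1F

    Degree<-certificate : ∀ S τ → Degree< (length S) (suc (3 * n * p)) (certificate S τ)
    Degree<-certificate S τ with nonzeroTriple? τ
    ... | no  _ = Degree<-mono (length S) (s≤s z≤n) (Degree<-const (length S) 1F)
    ... | yes _ = Degree<-kernelCount (length S) (λ ui v → Degree<-sum (length S) 2 (λ c →
      Degree<-* (length S) 1 0
        (Degree<-koszul (length S)
          (λ r → Degree<-sum (length S) 2 (λ l → Degree<-scale (length S) 1 (lookup (component τ r) l) (Degree<-masked S (shift r l) _)))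
          (quotient n ui) (block c))
        (Degree<-const (length S) (lookup v c))))

    -- Under the full mask the triple is the Toeplitz triple itself, whose kernel is trivial.
    certificate-all : ∀ S τ → All (λ (s , e) → μ s · e ≡ 1F) S → AllPairs Orthogonal S → Separates (selectedForms S) →
                      certificate S τ (replicate _ true) ≢ 0F
    certificate-all S τ unit orth sep with nonzeroTriple? τ
    ... | no  _  = 1F≢0F
    ... | yes nz = kernelCount-trivial⇒≢0 (rows X) (λ ui → row-0 X (quotient n ui) (remainder {3} n ui))
      (shift-trivialKernel δ δ-same δ-diff (component τ) nz X
        (λ r e → sum-cong (λ l → cong (lookup (component τ r) l *F_) (masked-all S (shift r l) unit orth sep e))))
      where X = triple S (replicate _ true) τ

    certificate-≢0⇒trivial : ∀ S τ J → (∀ r → ∃[ i ] lookup (component τ r) i ≢ 0F) → certificate S τ J ≢ 0F → TrivialKernel (rows (triple S J τ))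
    certificate-≢0⇒trivial S τ J nz cert≢0 with nonzeroTriple? τ
    ... | yes _  = kernelCount-≢0⇒trivial (rows (triple S J τ)) (λ ui → row-linear (triple S J τ) (quotient n ui) (remainder {3} n ui)) cert≢0
    ... | no ¬nz = contradiction nz ¬nz

    D : ℕ
    D = length coefficients * (3 * n * p)

    -- The product of all certificates is nonzero at the full mask, hence also at some mask of
    -- weight at most its degree D. There no factor vanishes, so this mask is good for all triples
    -- simultaneously.
    sparse-triples : ∀ {Φ} (sel : DualSelection Φ) → let open DualSelection sel in
      ∃[ J ] weight J ≤ D × (∀ τ → (∀ r → ∃[ i ] lookup (component τ r) i ≢ 0F) → TrivialKernel (rows (triple selected J τ)))
    sparse-triples sel =
      let J , Π≢0 , J<D = sparse-nonzero (length selected) (suc D)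
            (Degree<-listProduct (length selected) (3 * n * p) coefficients (Degree<-certificate selected))
            (replicate _ true) (listProduct-≢0 coefficients (λ τ → certificate-all selected τ unit orthogonal separates))
      in J , ℕₚ.≤-pred J<D , λ τ nz → certificate-≢0⇒trivial selected τ J nz (listProduct-≢0⁻ Π≢0 (∈-coefficients τ))
      where open DualSelection sel

    nonvanishing : (S : Selected) → Vec Bool (length S) → Term → Coefficients → ℕ
    nonvanishing S J φ τ = nonzeroIndicator (values (triple S J τ) φ)

    -- On the triple, φ takes three values, each linear in its own coefficient vector. Each is 0 for
    -- at least P choices, independently, so φ vanishes on at least P³ of the (p P)³ triples.
    ∑-nonvanishing : ∀ S J φ → ∑ coefficients (nonvanishing S J φ) + P * (P * P) ≤ length coefficients
    ∑-nonvanishing S J φ = begin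
      ∑ coefficients (nonvanishing S J φ) + P * (P * P)
        ≤⟨ ℕₚ.+-monoʳ-≤ _ (ℕₚ.*-mono-≤ (zeros-≥ κ (ψ #0)) (ℕₚ.*-mono-≤ (zeros-≥ κ (ψ #1)) (zeros-≥ κ (ψ #2)))) ⟩
      ∑ coefficients (nonvanishing S J φ) + ∑ vectors (zs #0) * (∑ vectors (zs #1) * ∑ vectors (zs #2))
        ≡⟨ cong (∑ coefficients (nonvanishing S J φ) +_) (sym (trans (∑-cartesianProduct-* vectors _ (zs #0) (λ (β , γ) → zs #1 β * zs #2 γ))
             (cong (∑ vectors (zs #0) *_) (∑-cartesianProduct-* vectors vectors (zs #1) (zs #2))))) ⟩
      ∑ coefficients (nonvanishing S J φ) + ∑ coefficients zs³
        ≡⟨ sym (∑-+ coefficients (nonvanishing S J φ) zs³) ⟩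
      ∑ coefficients (λ τ → nonvanishing S J φ τ + zs³ τ)
        ≡⟨ ∑-cong coefficients one ⟩
      ∑ coefficients (λ _ → 1)
        ≡⟨ trans (∑-const coefficients 1) (ℕₚ.*-identityʳ _) ⟩
      length coefficients ∎
      where
      open ℕₚ.≤-Reasoning
      ψ : Fin 3 → Fin (suc κ) → F
      ψ r l = μ φ · masked S J (shift r l)
      zs : Fin 3 → Vec F (suc κ) → ℕ
      zs r α = zeroIndicator (combination α (ψ r))
      zs³ : Coefficients → ℕ
      zs³ (α , β , γ) = zs #0 α * (zs #1 β * zs #2 γ)
      one : ∀ τ → nonvanishing S J φ τ + zs³ τ ≡ 1
      one τ@(α , β , γ) = trans (cong (nonvanishing S J φ τ +_)
        (cong₂ _*_ (zs≡ #0) (cong₂ _*_ (zs≡ #1) (zs≡ #2)))) (indicators (values (triple S J τ) φ))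
        where
        zs≡ : ∀ r → zs r (component τ r) ≡ zeroIndicator (values (triple S J τ) φ r)
        zs≡ r = cong zeroIndicator (sym (values-triple S J τ φ r))

    ∑-nonvanishing-≤ : ∀ S J φ → ∑ coefficients (nonvanishing S J φ) ≤ length coefficients
    ∑-nonvanishing-≤ S J φ = ℕₚ.≤-trans (ℕₚ.m≤m+n _ _) (∑-nonvanishing S J φ)

    vanishing : ∀ S J φ → (∀ x → μ φ · masked S J x ≡ 0F) → ∑ coefficients (nonvanishing S J φ) ≡ 0
    vanishing S J φ φ≡0 = ∑-zero coefficients (λ τ → nonzeroIndicator-0 (λ r → trans (values-triple S J τ φ r)
      (sum-zero (λ l → trans (cong (lookup (component τ r) l *F_) (φ≡0 (shift r l))) (zeroʳ _)))))

    unmasked-zero : ∀ (S : Selected) J (g : Term → ℕ) → Unmasked (λ (s , _) → ∀ x → μ s · masked S J x ≡ 0F) S J →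
      (∀ {φ} → (∀ x → μ φ · masked S J x ≡ 0F) → g φ ≡ 0) → Unmasked (λ (s , _) → g s ≡ 0) S J
    unmasked-zero S J g um h = Unmasked-map {Q = λ _ → ⊤} (λ _ → h) S J (All.universal (λ _ → tt) S) um

    -- Counts the zero vectors in a triple, so that a union bound limits the number of degenerate
    -- triples to 3 Q².
    zeroComponents : Coefficients → ℕ
    zeroComponents (α , β , γ) = zeroVecIndicator α + (zeroVecIndicator β + zeroVecIndicator γ)

    ∑-zeroComponents : ∑ coefficients zeroComponents ≤ 3 * (Q * Q)
    ∑-zeroComponents = begin
      ∑ coefficients zeroComponents
        ≡⟨ trans (∑-+ coefficients _ _) (cong (∑ coefficients (λ (α , _ , _) → zeroVecIndicator α) +_) (∑-+ coefficients _ _)) ⟩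
      ∑ coefficients (λ (α , _ , _) → zeroVecIndicator α) + (∑ coefficients (λ (_ , β , _) → zeroVecIndicator β) + ∑ coefficients (λ (_ , _ , γ) → zeroVecIndicator γ))
        ≤⟨ ℕₚ.+-mono-≤ first (ℕₚ.+-mono-≤ second third) ⟩
      Q * Q + (Q * Q + Q * Q)
        ≡⟨ cong (λ x → Q * Q + (Q * Q + x)) (sym (ℕₚ.+-identityʳ (Q * Q))) ⟩
      3 * (Q * Q) ∎
      where
      open ℕₚ.≤-Reasoning
      Z = ∑ vectors zeroVecIndicator
      len : length vectors ≡ Q
      len = length-allVec (suc κ)
      Z≤1 : Z ≤ 1
      Z≤1 = ∑-zeroVecIndicator (suc κ)
      first : ∑ coefficients (λ (α , _ , _) → zeroVecIndicator α) ≤ Q * Q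
      first = begin
        ∑ coefficients (λ (α , _ , _) → zeroVecIndicator α)
          ≡⟨ ∑-cong coefficients (λ _ → sym (ℕₚ.*-identityʳ _)) ⟩
        ∑ coefficients (λ (α , _ , _) → zeroVecIndicator α * 1)
          ≡⟨ ∑-cartesianProduct-* vectors (cartesianProduct vectors vectors) zeroVecIndicator (λ _ → 1) ⟩
        Z * ∑ (cartesianProduct vectors vectors) (λ _ → 1)
          ≡⟨ cong (Z *_) (trans (∑-const (cartesianProduct vectors vectors) 1) (trans (ℕₚ.*-identityʳ _) (trans (length-cartesianProductWith _,_ vectors vectors) (cong₂ _*_ len len)))) ⟩
        Z * (Q * Q)
          ≤⟨ ℕₚ.*-monoˡ-≤ (Q * Q) Z≤1 ⟩
        1 * (Q * Q)
          ≡⟨ ℕₚ.*-identityˡ _ ⟩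
        Q * Q ∎
      spread : ∀ (f : Vec F (suc κ) × Vec F (suc κ) → ℕ) → ∑ (cartesianProduct vectors vectors) f ≤ Q → ∑ coefficients (λ (_ , τ) → f τ) ≤ Q * Q
      spread f f≤Q = begin
        ∑ coefficients (λ (_ , τ) → f τ)
          ≡⟨ ∑-cartesianProductWith _,_ vectors (cartesianProduct vectors vectors) _ ⟩
        ∑ vectors (λ _ → ∑ (cartesianProduct vectors vectors) f)
          ≡⟨ trans (∑-const vectors _) (cong (_* ∑ (cartesianProduct vectors vectors) f) len) ⟩
        Q * ∑ (cartesianProduct vectors vectors) f
          ≤⟨ ℕₚ.*-monoʳ-≤ Q f≤Q ⟩
        Q * Q ∎
      second : ∑ coefficients (λ (_ , β , _) → zeroVecIndicator β) ≤ Q * Q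
      second = spread (λ (β , _) → zeroVecIndicator β) (begin
        ∑ (cartesianProduct vectors vectors) (λ (β , _) → zeroVecIndicator β)
          ≡⟨ ∑-cong (cartesianProduct vectors vectors) (λ _ → sym (ℕₚ.*-identityʳ _)) ⟩
        ∑ (cartesianProduct vectors vectors) (λ (β , _) → zeroVecIndicator β * 1)
          ≡⟨ ∑-cartesianProduct-* vectors vectors zeroVecIndicator (λ _ → 1) ⟩
        Z * ∑ vectors (λ _ → 1)
          ≡⟨ cong (Z *_) (trans (∑-const vectors 1) (trans (ℕₚ.*-identityʳ _) len)) ⟩
        Z * Q
          ≤⟨ ℕₚ.*-monoˡ-≤ Q Z≤1 ⟩
        1 * Q
          ≡⟨ ℕₚ.*-identityˡ Q ⟩
        Q ∎)
      third : ∑ coefficients (λ (_ , _ , γ) → zeroVecIndicator γ) ≤ Q * Q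
      third = spread (λ (_ , γ) → zeroVecIndicator γ) (begin
        ∑ (cartesianProduct vectors vectors) (λ (_ , γ) → zeroVecIndicator γ)
          ≡⟨ ∑-cartesianProductWith _,_ vectors vectors _ ⟩
        ∑ vectors (λ _ → Z)
          ≡⟨ trans (∑-const vectors Z) (cong (_* Z) len) ⟩
        Q * Z
          ≤⟨ ℕₚ.*-monoʳ-≤ Q Z≤1 ⟩
        Q * 1
          ≡⟨ ℕₚ.*-identityʳ Q ⟩
        Q ∎)

    zeroComponents-≥1 : ∀ τ → ¬ (∀ r → ∃[ i ] lookup (component τ r) i ≢ 0F) → 1 ≤ zeroComponents τ
    zeroComponents-≥1 (α , β , γ) ¬nz with nonzero? α
    ... | no _ = s≤s z≤n
    ... | yes α≢0 with nonzero? β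
    ...   | no _ = s≤s z≤n
    ...   | yes β≢0 with nonzero? γ
    ...     | no _ = s≤s z≤n
    ...     | yes γ≢0 = contradiction (λ { #0 → α≢0 ; #1 → β≢0 ; #2 → γ≢0 }) ¬nz

    -- The Koszul bound is summed over all triples and the two sums are exchanged. A selected form
    -- contributes nothing unless masked, and at most D are masked; each of the R others is charged
    -- all triples but P³.
    averaged-bound : ∀ Φ z → Computes Φ z → ∃[ R ] n * n + R ≤ length Φ ×
      Q * (Q * Q) * (s * n) + 2 * (R * (P * (P * P))) ≤
      2 * (Q * (Q * Q) * (3 * n * p) * (Q * (Q * Q)) + R * (Q * (Q * Q))) + s * n * (3 * (Q * Q))
    averaged-bound Φ z computes = length rest , size , subst (λ t →
        t * (s * n) + 2 * (length rest * (P * (P * P))) ≤ 2 * (t * (3 * n * p) * t + length rest * t) + s * n * (3 * (Q * Q)))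
        length-coefficients bound
      where
      sel = select Φ (computes⇒separates Φ z computes)
      open DualSelection sel
      J = proj₁ (sparse-triples sel)
      J≤D = proj₁ (proj₂ (sparse-triples sel))
      trivial = proj₂ (proj₂ (sparse-triples sel))
      nv = nonvanishing selected J
      t = length coefficients

      size : n * n + length rest ≤ length Φ
      size = begin
        n * n + length rest
          ≤⟨ ℕₚ.+-monoˡ-≤ (length rest) (subst (n * n ≤_) (length-map (μ ∘ proj₁) selected) (separates⇒≤ (selectedForms selected) separates)) ⟩
        length selected + length rest
          ≡⟨ sym (cong₂ _+_ (∑-1 selected) (∑-1 rest)) ⟩
        ∑ selected (λ _ → 1) + ∑ rest (λ _ → 1)
          ≡⟨ sym (splits (λ _ → 1)) ⟩
        ∑ Φ (λ _ → 1)
          ≡⟨ ∑-1 Φ ⟩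
        length Φ ∎
        where
        open ℕₚ.≤-Reasoning
        ∑-1 : ∀ {A : Set} (as : List A) → ∑ as (λ _ → 1) ≡ length as
        ∑-1 as = trans (∑-const as 1) (ℕₚ.*-identityʳ _)

      each : ∀ τ → s * n ≤ 2 * ∑ Φ (λ φ → nv φ τ) + s * n * zeroComponents τ
      each τ = go (nonzeroTriple? τ)
        where
        go : Dec (∀ r → ∃[ i ] lookup (component τ r) i ≢ 0F) → s * n ≤ 2 * ∑ Φ (λ φ → nv φ τ) + s * n * zeroComponents τ
        go (yes nz) = ℕₚ.≤-trans (koszul-bound Φ z computes (triple selected J τ) (trivial τ nz)) (ℕₚ.m≤m+n _ _)
        -- A degenerate triple satisfies no Koszul bound, so the whole left side is charged to its
        -- zero components.
        go (no ¬nz) = ℕₚ.≤-trans (ℕₚ.≤-reflexive (sym (ℕₚ.*-identityʳ (s * n))))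
          (ℕₚ.≤-trans (ℕₚ.*-monoʳ-≤ (s * n) (zeroComponents-≥1 τ ¬nz)) (ℕₚ.m≤n+m _ _))

      rest-bound : ∑ rest (λ φ → ∑ coefficients (nv φ)) + length rest * (P * (P * P)) ≤ length rest * t
      rest-bound = begin
        ∑ rest (λ φ → ∑ coefficients (nv φ)) + length rest * (P * (P * P))
          ≡⟨ cong (∑ rest (λ φ → ∑ coefficients (nv φ)) +_) (sym (∑-const rest (P * (P * P)))) ⟩
        ∑ rest (λ φ → ∑ coefficients (nv φ)) + ∑ rest (λ _ → P * (P * P))
          ≡⟨ sym (∑-+ rest _ _) ⟩
        ∑ rest (λ φ → ∑ coefficients (nv φ) + P * (P * P))
          ≤⟨ ∑-mono rest (∑-nonvanishing selected J) ⟩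
        ∑ rest (λ _ → t)
          ≡⟨ ∑-const rest t ⟩
        length rest * t ∎
        where open ℕₚ.≤-Reasoning

      selected-bound : ∑ selected (λ (φ , _) → ∑ coefficients (nv φ)) ≤ D * t
      selected-bound = ℕₚ.≤-trans
        (∑-unmasked (λ (φ , _) → ∑ coefficients (nv φ)) t (λ (φ , _) → ∑-nonvanishing-≤ selected J φ) selected J
          (unmasked-zero selected J (λ φ → ∑ coefficients (nv φ)) (unmasked-vanish selected J orthogonal) (λ {φ} → vanishing selected J φ)))
        (ℕₚ.*-monoˡ-≤ t J≤D)

      open ℕₚ.≤-Reasoning

      bound : t * (s * n) + 2 * (length rest * (P * (P * P))) ≤ 2 * (D * t + length rest * t) + s * n * (3 * (Q * Q))
      bound = begin
        t * (s * n) + 2 * (length rest * (P * (P * P)))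
          ≡⟨ cong (_+ 2 * (length rest * (P * (P * P)))) (sym (∑-const coefficients (s * n))) ⟩
        ∑ coefficients (λ _ → s * n) + 2 * (length rest * (P * (P * P)))
          ≤⟨ ℕₚ.+-monoˡ-≤ _ (∑-mono coefficients each) ⟩
        ∑ coefficients (λ τ → 2 * ∑ Φ (λ φ → nv φ τ) + s * n * zeroComponents τ) + 2 * (length rest * (P * (P * P)))
          ≡⟨ cong (_+ 2 * (length rest * (P * (P * P)))) (trans (∑-+ coefficients _ _) (cong₂ _+_ (∑-* coefficients 2 _) (∑-* coefficients (s * n) zeroComponents))) ⟩
        2 * ∑ coefficients (λ τ → ∑ Φ (λ φ → nv φ τ)) + s * n * ∑ coefficients zeroComponents + 2 * (length rest * (P * (P * P)))
          ≤⟨ ℕₚ.+-monoˡ-≤ _ (ℕₚ.+-mono-≤ (ℕₚ.≤-reflexive (cong (2 *_) (trans (∑-swap coefficients Φ (λ τ φ → nv φ τ)) (splits (λ φ → ∑ coefficients (nv φ))))))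
               (ℕₚ.*-monoʳ-≤ (s * n) ∑-zeroComponents)) ⟩
        2 * (Sel + Rest) + Z + 2 * (length rest * (P * (P * P)))
          ≡⟨ regroup Sel Rest Z (length rest * (P * (P * P))) ⟩
        2 * (Sel + (Rest + length rest * (P * (P * P)))) + Z
          ≤⟨ ℕₚ.+-monoˡ-≤ Z (ℕₚ.*-monoʳ-≤ 2 (ℕₚ.+-mono-≤ selected-bound rest-bound)) ⟩
        2 * (D * t + length rest * t) + Z ∎
        where
        Sel = ∑ selected (λ (φ , _) → ∑ coefficients (nv φ))
        Rest = ∑ rest (λ φ → ∑ coefficients (nv φ))
        Z = s * n * (3 * (Q * Q))
        regroup : ∀ a b c d → 2 * (a + b) + c + 2 * d ≡ 2 * (a + (b + d)) + c
        regroup = solve-∀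

  -- Bilinear forms computed by circuits

  module Span (n : ℕ) (δ : Fin n → Fin n → F) (δ-same : ∀ a → δ a a ≡ 1F) (δ-diff : ∀ {a b} → a ≢ b → δ a b ≡ 0F) where

    open Decomposition n δ δ-same δ-diff

    BilinearForm : Set
    BilinearForm = Fin n → Fin n → Fin n → Fin n → F

    evaluate : (Φ : List Term) → (Fin (length Φ) → F) → BilinearForm
    evaluate Φ z a b c d = sum (λ k → z k *F (μ (List.lookup Φ k) (combine a b) *F η (List.lookup Φ k) c d))

    Span : List Term → BilinearForm → Set
    Span Φ q = ∃[ z ] ∀ a b c d → q a b c d ≡ evaluate Φ z a b c d

    span-zero : ∀ {Φ q} → (∀ a b c d → q a b c d ≡ 0F) → Span Φ q
    span-zero q≡0 = (λ _ → 0F) , λ a b c d → trans (q≡0 a b c d) (sym (sum-zero (λ k → zeroˡ _)))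

    span-combination : ∀ {Φ k} (w : Fin k → F) (qs : Fin k → BilinearForm) {q} → (∀ j → Span Φ (qs j)) →
      (∀ a b c d → q a b c d ≡ sum (λ j → w j *F qs j a b c d)) → Span Φ q
    span-combination {Φ} w qs spans q≡ = (λ k → sum (λ j → w j *F proj₁ (spans j) k)) , λ a b c d →
      let t = λ k → μ (List.lookup Φ k) (combine a b) *F η (List.lookup Φ k) c d in
      trans (q≡ a b c d) (trans (sum-cong (λ j → trans (cong (w j *F_) (proj₂ (spans j) a b c d))
        (trans (*-sum (w j) _) (sum-cong (λ k → sym (*-assoc (w j) (proj₁ (spans j) k) (t k)))))))
        (trans (sum-comm _) (sum-cong (λ k → sym (sum-* _ (t k))))))

    span-weaken : ∀ {Φ q} φ → Span Φ q → Span (φ ∷ Φ) q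
    span-weaken {Φ} φ (z , q≡) = z′ , λ a b c d → trans (q≡ a b c d)
      (sym (trans (sum-suc _) (trans (cong₂ _+F_ (zeroˡ _) refl) (+-identityˡ _))))
      where
      z′ : Fin (suc (length Φ)) → F
      z′ zero    = 0F
      z′ (suc k) = z k

    span-head : ∀ {Φ q} φ w → (∀ a b c d → q a b c d ≡ w *F (μ φ (combine a b) *F η φ c d)) → Span (φ ∷ Φ) q
    span-head {Φ} φ w q≡ = z , λ a b c d → trans (q≡ a b c d) (sym (sum-single _ zero (λ { zero 0≢0 → contradiction refl 0≢0 ; (suc k) _ → zeroˡ _ })))
      where
      z : Fin (suc (length Φ)) → F
      z zero    = w
      z (suc k) = 0F

    -- Equality of coefficient tables becomes equality of values: the identity is linear in the
    -- first matrix, and summing it against the entries of x leaves only the position (i , b).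
    spans⇒computes : ∀ Φ (z : Fin n → Fin n → Fin (length Φ) → F) →
      (∀ i j a b c d → δ a i *F δ b c *F δ d j ≡ evaluate Φ (z i j) a b c d) → Computes Φ z
    spans⇒computes Φ z spans x i j b d = sym (trans (sum-cong unfold) (trans (sum-comm _) (trans (sum-cong fold) (trans (sum-single _ (combine i b) off) on))))
      where
      open Solver
      unfold : ∀ k → z i j k *F (μ (List.lookup Φ k) · x *F η (List.lookup Φ k) b d) ≡
        sum (λ e → (z i j k *F (μ (List.lookup Φ k) e *F η (List.lookup Φ k) b d)) *F x e)
      unfold k = trans (cong (z i j k *F_) (sum-* _ (η (List.lookup Φ k) b d))) (trans (*-sum (z i j k) _)
        (sum-cong (λ e → solve 4 (λ z m x h → z :* ((m :* x) :* h) := (z :* (m :* h)) :* x) refl (z i j k) (μ (List.lookup Φ k) e) (x e) (η (List.lookup Φ k) b d))))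
      entry : Fin (n * n) → F
      entry e = (δ (quotient n e) i *F δ (remainder {n} n e) b *F δ d j) *F x e
      fold : ∀ e → sum (λ k → (z i j k *F (μ (List.lookup Φ k) e *F η (List.lookup Φ k) b d)) *F x e) ≡ entry e
      fold e = trans (sym (sum-* _ (x e))) (cong (_*F x e) (trans
        (cong (λ e → sum (λ k → z i j k *F (μ (List.lookup Φ k) e *F η (List.lookup Φ k) b d))) (sym (combine-remQuot {n} n e)))
        (sym (spans i j (quotient n e) (remainder {n} n e) b d))))
      on : entry (combine i b) ≡ x (combine i b) *F δ d j
      on = trans (cong (λ q → (δ (proj₁ q) i *F δ (proj₂ q) b *F δ d j) *F x (combine i b)) (remQuot-combine {n} {n} i b))
        (trans (cong (λ y → y *F δ d j *F x (combine i b)) (trans (cong₂ _*F_ (δ-same i) (δ-same b)) (*-identityˡ 1F)))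
        (trans (cong (_*F x (combine i b)) (*-identityˡ (δ d j))) (*-comm (δ d j) _)))
      off : ∀ e → e ≢ combine i b → entry e ≡ 0F
      off e e≢ with quotient {n} n e ≟ i | remainder {n} n e ≟ b
      ... | yes q≡i | yes r≡b = contradiction (trans (sym (combine-remQuot {n} n e)) (cong₂ combine q≡i r≡b)) e≢
      ... | no q≢i  | _       = trans (cong (λ y → y *F δ (remainder {n} n e) b *F δ d j *F x e) (δ-diff q≢i))
        (trans (cong (λ y → y *F δ d j *F x e) (zeroˡ _)) (trans (cong (_*F x e) (zeroˡ _)) (zeroˡ _)))
      ... | yes _   | no r≢b  = trans (cong (λ y → δ (quotient n e) i *F y *F δ d j *F x e) (δ-diff r≢b))
        (trans (cong (λ y → y *F δ d j *F x e) (zeroʳ _)) (trans (cong (_*F x e) (zeroˡ _)) (zeroˡ _)))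

-- The integers modulo p as a prime field

module GaloisField (p : ℕ) .{{_ : NonZero p}} (pr : Prime p) where

  open GF p

  -- Reduction modulo p is a surjective semiring homomorphism, so the laws of `F` are inherited from
  -- the natural numbers.
  ι : ℕ → F
  ι m = m mod p

  toℕ-ι : ∀ m → toℕ (ι m) ≡ m % p
  toℕ-ι m = toℕ-fromℕ< (m%n<n m p)

  ι-cong : ∀ {m n} → m % p ≡ n % p → ι m ≡ ι n
  ι-cong {m} {n} eq = toℕ-injective (trans (toℕ-ι m) (trans eq (sym (toℕ-ι n))))

  ι-toℕ : ∀ a → ι (toℕ a) ≡ a
  ι-toℕ a = toℕ-injective (trans (toℕ-ι (toℕ a)) (m<n⇒m%n≡m (toℕ<n a)))

  ι-+ : ∀ m n → ι m +F ι n ≡ ι (m + n)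
  ι-+ m n = ι-cong (trans (cong₂ (λ x y → (x + y) % p) (toℕ-ι m) (toℕ-ι n)) (sym (%-distribˡ-+ m n p)))

  ι-* : ∀ m n → ι m *F ι n ≡ ι (m * n)
  ι-* m n = ι-cong (trans (cong₂ (λ x y → (x * y) % p) (toℕ-ι m) (toℕ-ι n)) (sym (%-distribˡ-* m n p)))

  +F-ιˡ : ∀ m b → ι m +F b ≡ ι (m + toℕ b)
  +F-ιˡ m b = trans (cong (ι m +F_) (sym (ι-toℕ b))) (ι-+ m (toℕ b))

  *F-ιˡ : ∀ m b → ι m *F b ≡ ι (m * toℕ b)
  *F-ιˡ m b = trans (cong (ι m *F_) (sym (ι-toℕ b))) (ι-* m (toℕ b))

  +F-comm : ∀ a b → a +F b ≡ b +F a
  +F-comm a b = cong ι (ℕₚ.+-comm (toℕ a) (toℕ b))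

  *F-comm : ∀ a b → a *F b ≡ b *F a
  *F-comm a b = cong ι (ℕₚ.*-comm (toℕ a) (toℕ b))

  +F-ιʳ : ∀ a n → a +F ι n ≡ ι (toℕ a + n)
  +F-ιʳ a n = trans (cong (_+F ι n) (sym (ι-toℕ a))) (ι-+ (toℕ a) n)

  *F-ιʳ : ∀ a n → a *F ι n ≡ ι (toℕ a * n)
  *F-ιʳ a n = trans (cong (_*F ι n) (sym (ι-toℕ a))) (ι-* (toℕ a) n)

  +F-assoc : ∀ a b c → (a +F b) +F c ≡ a +F (b +F c)
  +F-assoc a b c = trans (+F-ιˡ _ c) (trans (cong ι (ℕₚ.+-assoc (toℕ a) (toℕ b) (toℕ c))) (sym (+F-ιʳ a _)))

  *F-assoc : ∀ a b c → (a *F b) *F c ≡ a *F (b *F c)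
  *F-assoc a b c = trans (*F-ιˡ _ c) (trans (cong ι (ℕₚ.*-assoc (toℕ a) (toℕ b) (toℕ c))) (sym (*F-ιʳ a _)))

  +F-identityˡ : ∀ a → 0F +F a ≡ a
  +F-identityˡ a = trans (+F-ιˡ 0 a) (ι-toℕ a)

  +F-identityʳ : ∀ a → a +F 0F ≡ a
  +F-identityʳ a = trans (+F-comm a 0F) (+F-identityˡ a)

  *F-identityˡ : ∀ a → 1F *F a ≡ a
  *F-identityˡ a = trans (*F-ιˡ 1 a) (trans (cong ι (ℕₚ.*-identityˡ (toℕ a))) (ι-toℕ a))

  *F-identityʳ : ∀ a → a *F 1F ≡ a
  *F-identityʳ a = trans (*F-comm a 1F) (*F-identityˡ a)

  *F-distribˡ : ∀ a b c → a *F (b +F c) ≡ a *F b +F a *F c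
  *F-distribˡ a b c = trans (*F-ιʳ a _) (trans (cong ι (ℕₚ.*-distribˡ-+ (toℕ a) (toℕ b) (toℕ c))) (sym (ι-+ _ _)))

  *F-distribʳ : ∀ a b c → (b +F c) *F a ≡ b *F a +F c *F a
  *F-distribʳ a b c = trans (*F-comm (b +F c) a) (trans (*F-distribˡ a b c) (cong₂ _+F_ (*F-comm a b) (*F-comm a c)))

  *F-zeroˡ : ∀ a → 0F *F a ≡ 0F
  *F-zeroˡ a = *F-ιˡ 0 a

  *F-zeroʳ : ∀ a → a *F 0F ≡ 0F
  *F-zeroʳ a = trans (*F-comm a 0F) (*F-zeroˡ a)

  F-commutativeSemiring : CommutativeSemiring _ _
  F-commutativeSemiring = record
    { Carrier = F ; _≈_ = _≡_ ; _+_ = _+F_ ; _*_ = _*F_ ; 0# = 0F ; 1# = 1F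
    ; isCommutativeSemiring = record
      { isSemiring = record
        { isSemiringWithoutAnnihilatingZero = record
          { +-isCommutativeMonoid = record
            { isMonoid = record
              { isSemigroup = record
                { isMagma = record { isEquivalence = isEquivalence ; ∙-cong = cong₂ _+F_ }
                ; assoc = +F-assoc }
              ; identity = +F-identityˡ , +F-identityʳ }
            ; comm = +F-comm }
          ; *-cong = cong₂ _*F_
          ; *-assoc = *F-assoc
          ; *-identity = *F-identityˡ , *F-identityʳ
          ; distrib = *F-distribˡ , *F-distribʳ }
        ; zero = *F-zeroˡ , *F-zeroʳ }
      ; *-comm = *F-comm } }

  0%p≡0 : 0 % p ≡ 0
  0%p≡0 = m<n⇒m%n≡m (>-nonZero⁻¹ p)

  ι-p : ι p ≡ 0F
  ι-p = ι-cong (trans (n%n≡0 p) (sym (0%p≡0)))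

  -1F : F
  -1F = ι (p ∸ 1)

  -1F-inverse : 1F +F -1F ≡ 0F
  -1F-inverse = trans (ι-+ 1 (p ∸ 1)) (trans (cong ι (ℕₚ.m+[n∸m]≡n (>-nonZero⁻¹ p))) ι-p)

  infix 8 -F_
  -F_ : F → F
  -F a = -1F *F a

  +F-inverseʳ : ∀ a → a +F -F a ≡ 0F
  +F-inverseʳ a = trans (cong (_+F -F a) (sym (*F-identityˡ a)))
    (trans (sym (*F-distribʳ a 1F -1F)) (trans (cong (_*F a) -1F-inverse) (*F-zeroˡ a)))

  +F-cancelˡ : ∀ a {b c} → a +F b ≡ a +F c → b ≡ c
  +F-cancelˡ a {b} {c} eq = trans (sym (lem b)) (trans (cong (-F a +F_) eq) (lem c))
    where
    lem : ∀ b → -F a +F (a +F b) ≡ b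
    lem b = trans (sym (+F-assoc (-F a) a b))
              (trans (cong (_+F b) (trans (+F-comm (-F a) a) (+F-inverseʳ a))) (+F-identityˡ b))

  ι≡0⇒∣ : ∀ {m} → ι m ≡ 0F → p ∣ m
  ι≡0⇒∣ {m} eq = m%n≡0⇒n∣m m p (trans (sym (toℕ-ι m)) (trans (cong toℕ eq) (trans (toℕ-ι 0) (0%p≡0))))

  ∣toℕ⇒≡0 : ∀ {a : F} → p ∣ toℕ a → a ≡ 0F
  ∣toℕ⇒≡0 {a} p∣a with toℕ a in eq
  ... | zero  = trans (sym (ι-toℕ a)) (cong ι eq)
  ... | suc m = contradiction (∣⇒≤ p∣a) (ℕₚ.<⇒≱ (subst (_< p) eq (toℕ<n a)))

  *F-zero : ∀ a b → a *F b ≡ 0F → a ≡ 0F ⊎ b ≡ 0F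
  *F-zero a b eq with euclidsLemma (toℕ a) (toℕ b) pr (ι≡0⇒∣ eq)
  ... | inj₁ p∣a = inj₁ (∣toℕ⇒≡0 p∣a)
  ... | inj₂ p∣b = inj₂ (∣toℕ⇒≡0 p∣b)

  1F≢0F : 1F ≢ 0F
  1F≢0F eq = contradiction (∣⇒≤ (ι≡0⇒∣ {1} eq)) (ℕₚ.<⇒≱ (nonTrivial⇒n>1 p {{prime⇒nonTrivial pr}}))

  injective⇒surjective : ∀ {n} (f : Fin n → Fin n) → (∀ {i j} → f i ≡ f j → i ≡ j) → ∀ y → ∃[ x ] f x ≡ y
  injective⇒surjective {suc n} f inj y with any? (λ x → f x ≟ y)
  ... | yes found = found
  ... | no ¬found = contradiction (injective⇒≤ {f = λ x → punchOut (y≢f x)} (λ {i} {j} eq → inj (punchOut-injective (y≢f i) (y≢f j) eq))) ℕₚ.1+n≰n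
    where
    y≢f : ∀ x → y ≢ f x
    y≢f x eq = ¬found (x , sym eq)

  *F-cancelˡ : ∀ {a b c} → a ≢ 0F → a *F b ≡ a *F c → b ≡ c
  *F-cancelˡ {a} {b} {c} a≢0 eq with *F-zero a (b +F -F c)
    (trans (*F-distribˡ a b (-F c)) (trans (cong₂ _+F_ eq a*-c) (+F-inverseʳ (a *F c))))
    where
    a*-c : a *F -F c ≡ -F (a *F c)
    a*-c = trans (sym (*F-assoc a -1F c)) (trans (cong (_*F c) (*F-comm a -1F)) (*F-assoc -1F a c))
  ... | inj₁ a≡0 = contradiction a≡0 a≢0
  ... | inj₂ d≡0 = +F-cancelˡ (-F c)
    (trans (+F-comm (-F c) b) (trans d≡0 (sym (trans (+F-comm (-F c) c) (+F-inverseʳ c)))))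

  -- Multiplication by a ≠ 0 is injective on a finite set, hence it reaches 1.
  inverse : ∀ {a} → a ≢ 0F → ∃[ b ] a *F b ≡ 1F
  inverse {a} a≢0 = injective⇒surjective (a *F_) (*F-cancelˡ a≢0) 1F

  foldr-1F : ∀ k → Vector.foldr _+F_ 0F {k} (λ _ → 1F) ≡ ι k
  foldr-1F zero    = refl
  foldr-1F (suc k) = trans (cong (1F +F_) (foldr-1F k)) (ι-+ 1 k)

  primeField : PrimeField p
  primeField = record
    { _+F_ = _+F_ ; _*F_ = _*F_ ; 0F = 0F ; 1F = 1F ; -1F = -1F
    ; isCommutativeSemiring = CommutativeSemiring.isCommutativeSemiring F-commutativeSemiring
    ; -1F-inverse = -1F-inverse ; 1F≢0F = 1F≢0F ; inverse = inverse
    ; characteristic = trans (foldr-1F p) ι-p }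

-- From bilinear circuits to sums of terms

module CircuitTerms (p : ℕ) .{{_ : NonZero p}} (pr : Prime p) (n : ℕ) where
  open Circuits p n
  open GaloisField p pr using (+F-identityʳ; +F-identityˡ; *F-zeroˡ; *F-zeroʳ)

  K : PrimeField p
  K = GaloisField.primeField p pr

  open Field K using (sum; sum-empty; sum-suc)

  δ-same : ∀ a → δ a a ≡ 1F
  δ-same a with a ≟ a
  ... | yes _   = refl
  ... | no  a≢a = contradiction refl a≢a

  δ-diff : ∀ {a b} → a ≢ b → δ a b ≡ 0F
  δ-diff {a} {b} a≢b with a ≟ b
  ... | yes a≡b = contradiction a≡b a≢b
  ... | no  _   = refl

  open Field.Decomposition K n δ δ-same δ-diff using (Term; Computes)
  open Field.Span K n δ δ-same δ-diff

  ΣF≡sum : ∀ k (f : Fin k → F) → ΣF k f ≡ sum f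
  ΣF≡sum zero    f = sym (sum-empty f)
  ΣF≡sum (suc k) f = trans (cong (f zero +F_) (ΣF≡sum k (λ i → f (suc i)))) (sym (sum-suc f))

  productTerm : Val → Val → Term
  productTerm u v = (λ e → lx u (quotient n e) (remainder {n} n e)) , ly v

  span-productTerm : ∀ {Φ q} u v w → (∀ a b c d → q a b c d ≡ w *F (lx u a b *F ly v c d)) → Span (productTerm u v ∷ Φ) q
  span-productTerm {Φ} u v w q≡ = span-head {Φ} (productTerm u v) w (λ a b c d → trans (q≡ a b c d)
    (cong (λ ab → w *F (lx u (proj₁ ab) (proj₂ ab) *F ly v c d)) (sym (remQuot-combine {n} {n} a b))))

  Decomposes : ∀ {k} → Circuit k → List Term → Set
  Decomposes Γ Φ = length Φ ≡ productGates Γ × (∀ i → Span Φ (q (values Γ i)))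

  -- Inputs have no quadratic part and sum gates stay within the span of what is already there, so
  -- only product gates enlarge it, each by one term.
  decompose : ∀ {k} (Γ : Circuit k) → IsBilinear Γ → ∃[ Φ ] Decomposes Γ Φ
  decompose []      _          = [] , refl , λ ()
  decompose (Γ ▷ g) (bΓ , bg) with decompose Γ bΓ
  decompose (Γ ▷ inX i j) (bΓ , bg) | Φ , len , spans =
    Φ , trans len (sym (ℕₚ.+-identityʳ _)) , λ { zero → span-zero {Φ} (λ _ _ _ _ → refl) ; (suc k) → spans k }
  decompose (Γ ▷ inY i j) (bΓ , bg) | Φ , len , spans =
    Φ , trans len (sym (ℕₚ.+-identityʳ _)) , λ { zero → span-zero {Φ} (λ _ _ _ _ → refl) ; (suc k) → spans k }
  decompose (Γ ▷ sumG w) (bΓ , bg) | Φ , len , spans =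
    Φ , trans len (sym (ℕₚ.+-identityʳ _)) , λ
      { zero → span-combination {Φ} w (λ j → q (values Γ j)) spans (λ a b c d → ΣF≡sum _ _) ; (suc k) → spans k }
  -- Of the two summands in `mul`, bilinearity leaves one; which one depends on the factor that is
  -- the form in x.
  decompose (Γ ▷ prodG α i β j) (bΓ , inj₁ ((lyᵢ≡0 , _) , _)) | Φ , len , spans =
    productTerm (values Γ i) (values Γ j) ∷ Φ , trans (cong suc len) (ℕₚ.+-comm 1 _) , λ
      { zero → span-productTerm {Φ} (values Γ i) (values Γ j) (α *F β) (λ a b c d → cong ((α *F β) *F_)
          (trans (cong (lx (values Γ i) a b *F ly (values Γ j) c d +F_) (trans (cong (lx (values Γ j) a b *F_) (lyᵢ≡0 c d)) (*F-zeroʳ (lx (values Γ j) a b)))) (+F-identityʳ (lx (values Γ i) a b *F ly (values Γ j) c d))))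
      ; (suc k) → span-weaken {Φ} _ (spans k) }
  decompose (Γ ▷ prodG α i β j) (bΓ , inj₂ ((lxᵢ≡0 , _) , _)) | Φ , len , spans =
    productTerm (values Γ j) (values Γ i) ∷ Φ , trans (cong suc len) (ℕₚ.+-comm 1 _) , λ
      { zero → span-productTerm {Φ} (values Γ j) (values Γ i) (α *F β) (λ a b c d → cong ((α *F β) *F_)
          (trans (cong (_+F lx (values Γ j) a b *F ly (values Γ i) c d) (trans (cong (_*F ly (values Γ j) c d) (lxᵢ≡0 a b)) (*F-zeroˡ (ly (values Γ j) c d)))) (+F-identityˡ (lx (values Γ j) a b *F ly (values Γ i) c d))))
      ; (suc k) → span-weaken {Φ} _ (spans k) }

  circuit-computes : ∀ {s} (Γ : Circuit s) → IsBilinear Γ → (out : Fin n → Fin n → Fin s) → ComputesMatMul Γ out →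
    ∃[ Φ ] length Φ ≡ productGates Γ × ∃[ z ] Computes Φ z
  circuit-computes Γ bΓ out correct with decompose Γ bΓ
  ... | Φ , len , spans = Φ , len , (λ i j → proj₁ (spans (out i j))) ,
    spans⇒computes Φ (λ i j → proj₁ (spans (out i j))) (λ i j a b c d → trans (sym (proj₂ (proj₂ (correct i j)) a b c d)) (proj₂ (spans (out i j)) a b c d))

theorem4 : (p : ℕ) .{{_ : NonZero p}} → Prime p →
    ∃[ C ] ∀ (n : ℕ) → 1 ≤ n → ∀ {s} (Γ : Circuits.Circuit p n s) →
    Circuits.IsBilinear p n Γ →
    (out : Fin n → Fin n → Fin s) → Circuits.ComputesMatMul p n Γ out →
    LeqPlusRoot74 ((5 * (p ^ 3 ∸ 1) + 3) * (n * n))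
    (2 * (p ^ 3 ∸ 1) * Circuits.productGates p n Γ)
    (C * (2 * (p ^ 3 ∸ 1))) n
theorem4 p pr = constant p , λ n 1≤n Γ bΓ out correct →
  let open CircuitTerms p pr n
      1<p = Field.1<p K
      -- The lower estimate turns errors of order n P³ into n^(7/4); the upper one makes degenerate
      -- triples rare enough to fit into the same order.
      κ , P⁴≤n , n<Q⁴ = fourthPower-between p 1<p n 1≤n
      Φ , len , z , computes = circuit-computes Γ bΓ out correct
      R , n²+R≤m , bound = Field.Averaging.averaged-bound K n ⌊ n /2⌋ κ (⌊n/2⌋+⌊n/2⌋≤n n) _ δ-same δ-diff Φ z computes
      P = p ^ κ
      S = 3 * (2 * (⌊ n /2⌋ ∸ κ))
      1≤P³ = 1≤cube {P} (ℕₚ.m^n>0 p κ)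
      instance _ = >-nonZero 1≤P³
  in fourthPower-bound (constant p) n P _ _ (2 * (p ^ 3 ∸ 1)) (1≤2c 1<p) P⁴≤n
       (leading-term p P n (Circuits.productGates p n Γ) R S κ (p ^ 3 ∸ 1) (cube≡ 1<p)
         (ℕₚ.≤-trans (ℕₚ.<⇒≤ (n<p^n p 1<p κ)) (x≤cube (ℕₚ.m^n>0 p κ))) 1≤P³ (columns-≥ n κ) (subst (n * n + R ≤_) len n²+R≤m)
         (averaged-cancelled p P n R S (columns-≤ n κ) (ℕₚ.<⇒≤ n<Q⁴) bound))
  where
  1≤cube : ∀ {x} → 1 ≤ x → 1 ≤ cube x
  1≤cube 1≤x = ℕₚ.*-mono-≤ 1≤x (ℕₚ.*-mono-≤ 1≤x 1≤x)
  x≤cube : ∀ {x} → 1 ≤ x → x ≤ cube x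
  x≤cube {x} 1≤x = ℕₚ.≤-trans (ℕₚ.≤-reflexive (sym (ℕₚ.*-identityʳ x))) (ℕₚ.*-monoʳ-≤ x (ℕₚ.*-mono-≤ 1≤x 1≤x))
  cube≡ : 1 < p → cube p ≡ suc (p ^ 3 ∸ 1)
  cube≡ 1<p = trans (cong (λ x → p * (p * x)) (sym (ℕₚ.*-identityʳ p))) (sym (ℕₚ.m+[n∸m]≡n (ℕₚ.m^n>0 p 3)))
  1≤2c : 1 < p → 1 ≤ 2 * (p ^ 3 ∸ 1)
  1≤2c 1<p = ℕₚ.≤-trans (ℕₚ.∸-monoˡ-≤ 1 (ℕₚ.≤-trans 1<p (ℕₚ.≤-trans (ℕₚ.≤-reflexive (sym (ℕₚ.^-identityʳ p))) (ℕₚ.^-monoʳ-≤ p {1} {3} (s≤s z≤n))))) (ℕₚ.m≤m+n _ _)
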